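{- There is no on-line algorithm with strict competitive ratio less than $\frac{7}{4}$ for the on-line coloring problem restricted to unit interval graphs with known proper interval representation. That is, for every on-line coloring algorithm $A$ for unit interval graphs presented together with a proper interval representation, the strict competitive ratio of $A$ is at least $\frac{7}{4}$.
   Context: A graph $G=(V,E)$ is an interval graph if there is a function $f$ assigning to each vertex $v\in V$ a closed interval $f(v)$ on the real line so that distinct vertices $u,v$ are adjacent if and only if $f(u)\cap f(v)\neq\emptyset$; $f$ is called an interval representation of $G$. If no interval is properly contained in any other interval, $f$ is called a proper interval representation and $G$ a proper interval graph. If every interval has unit length, $f$ is a unit interval representation and $G$ is a unit interval graph. An interval graph is a unit interval graph if and only if it is a proper interval graph. All graphs are finite. On-line coloring with known proper interval representation: the vertices $v_1,\dots,v_n$ of a unit interval graph $G$ are presented one at a time, each vertex $v_i$ being presented as its interval $f(v_i)$ in some proper interval representation $f$ of $G$. A (deterministic) on-line algorithm $A$ must immediately and irrevocably assign to $v_i$ a color different from the colors of all previously presented vertices adjacent to $v_i$ (i.e. whose intervals intersect $f(v_i)$). The color assigned to $v_i$ depends only on the intervals $f(v_1),\dots,f(v_i)$ presented so far (in their order) and on the colors already assigned to $v_1,\dots,v_{i-1}$. Let $\chi(G)$ denote the chromatic number of $G$, and let $\chi_A(G)$ denote the maximum number of colors used by $A$ on $G$ over all ways of presenting $G$ (all orderings of the vertices and all proper interval representations). The algorithm $A$ is strictly $\rho$-competitive if $\chi_A(G)\le \rho\cdot\chi(G)$ for every unit interval graph $G$. The strict competitive ratio of $A$ is $\inf\{\rho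 \mid A \text{ is strictly } \rho\text{ -competitive}\}$ (taken to be $+\infty$ if there is no such $\rho$). -}

module Defs where

open import Algebra.Bundles.Raw using (RawMonoid)
import Algebra.Definitions.RawMonoid as RawMonoidDefinitions
open import Data.Fin.Base using (Fin)
open import Data.Fin.Permutation using (Permutation′; _⟨$⟩ʳ_; _⟨$⟩ˡ_)
open import Data.Integer.Base using (+_)
open import Data.List.Base using (List; []; _∷ʳ_; length; deduplicate)
open import Data.Nat.Base as ℕ using (ℕ; _⊔_)
import Data.Nat.Properties as ℕ
open import Data.Product.Base using (∃; _×_; _,_)
open import Data.Rational.Base as ℚ using (ℚ; 0ℚ; 1ℚ; ½)
import Data.Rational.Properties as ℚ
open import Data.Rational.Solver using (module +-*-Solver)
open import Data.Vec.Base using (Vec; []; _∷_; lookup; tabulate; toList)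
open import Function.Bundles using (_⇔_)
open import Level using (0ℓ) renaming (suc to lsuc)
open import Relation.Binary.Core using (Rel)
open import Relation.Binary.Definitions using (Decidable; Symmetric)
open import Relation.Binary.PropositionalEquality
open import Relation.Nullary using (¬_)
open import Relation.Unary using (Pred; _∈_; _≬_; _⊂_)

-- Real numbers: Cauchy sequences of rationals, compared up to _≈_.

record ℝ : Set where
  field
    seq    : ℕ → ℚ
    cauchy : ∀ ε → 0ℚ ℚ.< ε →
             ∃ λ N → ∀ m n → N ℕ.≤ m → N ℕ.≤ n → ℚ.∣ seq m ℚ.- seq n ∣ ℚ.< ε

open ℝ public

infix 4 _<_ _≤_ _≈_
infixl 6 _+_

_<_ : Rel ℝ 0ℓ
x < y = ∃ λ ε → 0ℚ ℚ.< ε × ∃ λ N → ∀ n → N ℕ.≤ n → seq x n ℚ.+ ε ℚ.≤ seq y n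

_≤_ : Rel ℝ 0ℓ
x ≤ y = ¬ (y < x)

_≈_ : Rel ℝ 0ℓ
x ≈ y = x ≤ y × y ≤ x

fromℚ : ℚ → ℝ
fromℚ q .seq _ = q
fromℚ q .cauchy ε 0<ε = 0 , λ _ _ _ _ →
  subst (λ p → ℚ.∣ p ∣ ℚ.< ε) (sym (ℚ.+-inverseʳ q)) 0<ε

fromℕ : ℕ → ℝ
fromℕ k = fromℚ (+ k ℚ./ 1)

_+_ : ℝ → ℝ → ℝ
(x + y) .seq n = seq x n ℚ.+ seq y n
(x + y) .cauchy ε 0<ε =
  let δ     = ½ ℚ.* ε
      0<δ   = subst (ℚ._< δ) (ℚ.*-zeroʳ ½) (ℚ.*-monoʳ-<-pos ½ 0<ε)
      M , p = cauchy x δ 0<δ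
      N , q = cauchy y δ 0<δ
  in M ⊔ N , λ m n m≥ n≥ → begin-strict
    ℚ.∣ (seq x m ℚ.+ seq y m) ℚ.- (seq x n ℚ.+ seq y n) ∣
      ≡⟨ cong ℚ.∣_∣ (regroup (seq x m) (seq y m) (seq x n) (seq y n)) ⟩
    ℚ.∣ (seq x m ℚ.- seq x n) ℚ.+ (seq y m ℚ.- seq y n) ∣
      ≤⟨ ℚ.∣p+q∣≤∣p∣+∣q∣ (seq x m ℚ.- seq x n) (seq y m ℚ.- seq y n) ⟩
    ℚ.∣ seq x m ℚ.- seq x n ∣ ℚ.+ ℚ.∣ seq y m ℚ.- seq y n ∣
      <⟨ ℚ.+-mono-< (p m n (ℕ.m⊔n≤o⇒m≤o M N m≥) (ℕ.m⊔n≤o⇒m≤o M N n≥))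
                    (q m n (ℕ.m⊔n≤o⇒n≤o M N m≥) (ℕ.m⊔n≤o⇒n≤o M N n≥)) ⟩
    δ ℚ.+ δ
      ≡⟨ ℚ.*-distribʳ-+ ε ½ ½ ⟨
    1ℚ ℚ.* ε
      ≡⟨ ℚ.*-identityˡ ε ⟩
    ε ∎
  where
  open ℚ.≤-Reasoning
  open +-*-Solver
  regroup : ∀ a b c d → (a ℚ.+ b) ℚ.- (c ℚ.+ d) ≡ (a ℚ.- c) ℚ.+ (b ℚ.- d)
  regroup = solve 4 (λ a b c d → (a :+ b) :- (c :+ d) := (a :- c) :+ (b :- d)) refl

+-rawMonoid : RawMonoid 0ℓ 0ℓ
+-rawMonoid = record { Carrier = ℝ ; _≈_ = _≈_ ; _∙_ = _+_ ; ε = fromℚ 0ℚ }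

-- k · x is the k-fold sum x + ... + x.
open RawMonoidDefinitions +-rawMonoid public using () renaming (_×_ to _·_)

-- An extended real is given by the set of rationals strictly above it;
-- the empty set is +∞.  In this form every set of reals has an infimum.

UpperReal : Set₂
UpperReal = Pred ℚ (lsuc 0ℓ)

inf : Pred ℝ (lsuc 0ℓ) → UpperReal
inf S q = ∃ λ ρ → ρ ∈ S × ρ < fromℚ q

infix 4 _≤ᵘ_

_≤ᵘ_ : ℝ → UpperReal → Set₁
x ≤ᵘ U = ∀ q → q ∈ U → x < fromℚ q

record Graph : Set₁ where
  infix 4 _~_ _~?_
  field
    order    : ℕ
    _~_      : Rel (Fin order) 0ℓ
    _~?_     : Decidable _~_
    ~-sym    : Symmetric _~_
    ~-irrefl : ∀ {v} → ¬ (v ~ v)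

  Vertex : Set
  Vertex = Fin order

open Graph using (order; Vertex)

Proper : {C : Set} (G : Graph) → (Vertex G → C) → Set
Proper G c = ∀ {u v} → u ~ v → c u ≢ c v
  where open Graph G using (_~_)

Colourable : Graph → ℕ → Set
Colourable G k = ∃ λ (c : Vertex G → Fin k) → Proper G c

IsChromaticNumber : Graph → ℕ → Set
IsChromaticNumber G k = Colourable G k × (∀ j → Colourable G j → k ℕ.≤ j)

record Interval : Set where
  field
    lo hi : ℝ
    lo≤hi : lo ≤ hi

open Interval public

⟦_⟧ : Interval → Pred ℝ 0ℓ
⟦ I ⟧ x = lo I ≤ x × x ≤ hi I

IsRepresentation : (G : Graph) → (Vertex G → Interval) → Set
IsRepresentation G f = ∀ {u v} → u ≢ v → (u ~ v ⇔ ⟦ f u ⟧ ≬ ⟦ f v ⟧)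
  where open Graph G using (_~_)

IsProperRepresentation : (G : Graph) → (Vertex G → Interval) → Set
IsProperRepresentation G f =
  IsRepresentation G f × (∀ u v → ¬ (⟦ f u ⟧ ⊂ ⟦ f v ⟧))

IsUnitRepresentation : (G : Graph) → (Vertex G → Interval) → Set
IsUnitRepresentation G f =
  IsRepresentation G f × (∀ v → hi (f v) ≈ lo (f v) + fromℚ 1ℚ)

IsUnitIntervalGraph : Graph → Set
IsUnitIntervalGraph G = ∃ (IsUnitRepresentation G)

record Presentation (G : Graph) : Set where
  field
    rep      : Vertex G → Interval
    isProper : IsProperRepresentation G rep
    -- arrival ⟨$⟩ʳ i is the i-th vertex to be presented.
    arrival  : Permutation′ (order G)

  intervals : Vec Interval (order G)
  intervals = tabulate (λ i → rep (arrival ⟨$⟩ʳ i))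

-- From the intervals presented so far with their colours, in order of
-- presentation, and the new interval, to the colour of the new interval.
-- The colour may depend on the Cauchy sequences given for the endpoints, not
-- only on the reals they represent: no function respecting _≈_ is assumed.

Strategy : Set
Strategy = List (Interval × ℕ) → Interval → ℕ

run : Strategy → ∀ {n} → List (Interval × ℕ) → Vec Interval n → Vec ℕ n
run s past []       = []
run s past (I ∷ Is) = s past I ∷ run s (past ∷ʳ (I , s past I)) Is

module _ (s : Strategy) {G : Graph} (P : Presentation G) where
  open Presentation P

  colours : Vec ℕ (order G)
  colours = run s [] intervals

  colouring : Vertex G → ℕ
  colouring v = lookup colours (arrival ⟨$⟩ˡ v)

  coloursUsed : ℕ
  coloursUsed = length (deduplicate ℕ._≟_ (toList colours))

record OnlineAlgorithm : Set₁ where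
  field
    strategy : Strategy
    legal    : ∀ {G} → IsUnitIntervalGraph G → (P : Presentation G) →
               Proper G (colouring strategy P)

open OnlineAlgorithm public

IsOnlineChromaticNumber : OnlineAlgorithm → Graph → ℕ → Set
IsOnlineChromaticNumber A G m =
  (∃ λ (P : Presentation G) → coloursUsed (strategy A) P ≡ m) ×
  (∀ (P : Presentation G) → coloursUsed (strategy A) P ℕ.≤ m)

StrictlyCompetitive : OnlineAlgorithm → Pred ℝ (lsuc 0ℓ)
StrictlyCompetitive A ρ =
  ∀ G → IsUnitIntervalGraph G →
  ∀ m k → IsOnlineChromaticNumber A G m → IsChromaticNumber G k →
  fromℕ m ≤ k · ρ

strictCompetitiveRatio : OnlineAlgorithm → UpperReal
strictCompetitiveRatio A = inf (StrictlyCompetitive A)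

{-# OPTIONS --safe #-}
-- An adversary forces a seventh colour on a unit interval graph that is
-- 4-colourable, which gives 7 ≤ 4 ρ for every competitive ρ.  The adversary follows
-- a finite tree: a node names the interval to be presented, and it has one subtree
-- for every reply that leaves at most six colours in use, up to renaming of
-- the colours.  Proper representations make this possible: an interval to be
-- presented later can be squeezed anywhere, although the final graph must also
-- have a unit representation.  That the tree wins is decided by evaluation,
-- which at each leaf constructs a unit representation and a 4-colouring and
-- verifies them; no general theorem on proper interval graphs is needed.
-- The chromatic numbers required by the definition of the ratio exist only up to double
-- negation, but that is enough because the conclusion is a decidable
-- inequality between rationals.
module Submission where

open import Defs
open import Data.Bool.Base using (Bool; true; false; if_then_else_; T; _∧_)
open import Data.Bool.Properties using (T-∧; T?)
open import Data.Empty using (⊥-elim)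
open import Data.Fin.Base using (Fin; zero; suc)
import Data.Fin.Permutation as Permutation
import Data.Fin.Properties as Fin
open import Data.Integer.Base as ℤ using (+_)
import Data.Integer.Properties as ℤ
open import Data.List.Base
  using (List; []; _∷_; _∷ʳ_; _++_; [_]; length; lookup; map; foldr; foldl; tabulate)
open import Data.List.Membership.Propositional using (_∈_)
open import Data.List.Membership.Propositional.Properties
  using (∈-lookup; ∈-∃++; ∈-++⁺ˡ; ∈-++⁺ʳ; ∈-++⁻; ∈-map⁺; ∈-map⁻; ∈-tabulate⁻; ∈-deduplicate⁺)
import Data.List.Properties as List
open import Data.List.Relation.Binary.Pointwise as Pointwise using (Pointwise; []; _∷_)
open import Data.List.Relation.Unary.All as All using (All; []; _∷_)
import Data.List.Relation.Unary.All.Properties as All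
open import Data.List.Relation.Unary.AllPairs using (AllPairs; []; _∷_; allPairs?)
import Data.List.Relation.Unary.AllPairs.Properties as AllPairs
open import Data.List.Relation.Unary.Any using (Any; any?; here; there)
open import Data.List.Relation.Unary.Unique.Propositional using (Unique)
open import Data.Nat.Base as ℕ
  using (ℕ; zero; suc; z≤n; s≤s; _≡ᵇ_; _≤ᵇ_; _<ᵇ_; _⊔′_; _⊓′_)
open import Data.Nat.DivMod as ℕ using (_mod_)
open import Data.Nat.Induction using (<-rec)
import Data.Nat.Properties as ℕ
open import Data.Product.Base as Product using (∃; _×_; _,_; proj₁; proj₂; map₁; swap)
open import Data.Rational.Base as ℚ using (ℚ; 0ℚ; 1ℚ; _/_; fromℚᵘ; toℚᵘ)
import Data.Rational.Properties as ℚ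
open import Data.Rational.Solver using (module +-*-Solver)
open import Data.Rational.Unnormalised.Base as ℚᵘ using (mkℚᵘ)
import Data.Rational.Unnormalised.Properties as ℚᵘ
open import Data.Sum.Base as Sum using (_⊎_; inj₁; inj₂; [_,_]′)
import Data.Vec.Base as Vec
import Data.Vec.Membership.Propositional.Properties as Vec
import Data.Vec.Properties as Vec
open import Function.Base using (_∘_; _on_)
open import Function.Bundles using (_⇔_; mk⇔; Equivalence)
open import Level using (0ℓ)
open import Relation.Binary.Core using (Rel)
open import Relation.Binary.Definitions using (Decidable; Symmetric)
open import Relation.Binary.PropositionalEquality hiding ([_])
open import Relation.Nullary
  using (¬_; Dec; does; isYes; yes; no; contradiction; ¬?; _×-dec_; _⊎-dec_; _→-dec_)
open import Relation.Nullary.Decidable using (True; from-yes; map′; toWitness)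
open import Relation.Unary using (_≬_; _⊂_) renaming (_∈_ to _∈ᵘ_)

-- The order of the reals on rational constants.

p<q⇒0<q-p : ∀ {p q} → p ℚ.< q → 0ℚ ℚ.< q ℚ.- p
p<q⇒0<q-p {p} {q} p<q =
  subst (ℚ._< q ℚ.- p) (ℚ.+-inverseʳ p) (ℚ.+-monoˡ-< (ℚ.- p) p<q)

fromℚ-mono-< : ∀ {p q} → p ℚ.< q → fromℚ p < fromℚ q
fromℚ-mono-< {p} {q} p<q =
  q ℚ.- p , p<q⇒0<q-p p<q , 0 , λ _ _ → ℚ.≤-reflexive (solve 2 (λ p q → p :+ (q :- p) := q) refl p q)
  where
  open +-*-Solver

p<p+ε : ∀ {p ε} → 0ℚ ℚ.< ε → p ℚ.< p ℚ.+ ε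
p<p+ε {p} {ε} 0<ε = subst (ℚ._< p ℚ.+ ε) (ℚ.+-identityʳ p) (ℚ.+-monoʳ-< p 0<ε)

fromℚ-cancel-< : ∀ {p q} → fromℚ p < fromℚ q → p ℚ.< q
fromℚ-cancel-< (_ , 0<ε , N , p+ε≤q) = ℚ.<-≤-trans (p<p+ε 0<ε) (p+ε≤q N ℕ.≤-refl)

fromℚ-mono-≤ : ∀ {p q} → p ℚ.≤ q → fromℚ p ≤ fromℚ q
fromℚ-mono-≤ p≤q q<p = ℚ.<-irrefl refl (ℚ.≤-<-trans p≤q (fromℚ-cancel-< q<p))

fromℚ-cancel-≤ : ∀ {p q} → fromℚ p ≤ fromℚ q → p ℚ.≤ q
fromℚ-cancel-≤ p≤q = ℚ.≮⇒≥ (p≤q ∘ fromℚ-mono-<)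

p≤∣p∣ : ∀ p → p ℚ.≤ ℚ.∣ p ∣
p≤∣p∣ p with ℚ.≤-total 0ℚ p
... | inj₁ 0≤p = ℚ.≤-reflexive (sym (ℚ.0≤p⇒∣p∣≡p 0≤p))
... | inj₂ p≤0 = ℚ.≤-trans p≤0 (ℚ.0≤∣p∣ p)

∣p-q∣<ε⇒p≤q+ε : ∀ {p q ε} → ℚ.∣ p ℚ.- q ∣ ℚ.< ε → p ℚ.≤ q ℚ.+ ε
∣p-q∣<ε⇒p≤q+ε {p} {q} {ε} ∣p-q∣<ε = begin
  p                ≡⟨ solve 2 (λ p q → p := q :+ (p :- q)) refl p q ⟩
  q ℚ.+ (p ℚ.- q)  ≤⟨ ℚ.+-monoʳ-≤ q (ℚ.≤-trans (p≤∣p∣ (p ℚ.- q)) (ℚ.<⇒≤ ∣p-q∣<ε)) ⟩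
  q ℚ.+ ε          ∎
  where
  open ℚ.≤-Reasoning
  open +-*-Solver

-- A late enough term of x lies above or below the midpoint of p and q.
<-cotrans : ∀ {p q} → p ℚ.< q → ∀ x → fromℚ p < x ⊎ x < fromℚ q
<-cotrans {p} {q} p<q x = case
  where
  open ℚ.≤-Reasoning
  open +-*-Solver
  δ : ℚ
  -- A quarter of the gap: the midpoint is `p + (δ + δ)`, one `δ` is lost to the oscillation of the
  -- tail of `x`, and one is left as the witness of strict inequality.
  δ = (+ 1 / 4) ℚ.* (q ℚ.- p)
  0<δ : 0ℚ ℚ.< δ
  0<δ = subst (ℚ._< δ) (ℚ.*-zeroʳ (+ 1 / 4)) (ℚ.*-monoʳ-<-pos (+ 1 / 4) (p<q⇒0<q-p p<q))
  N : ℕ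
  N = proj₁ (cauchy x δ 0<δ)
  near : ∀ m n → N ℕ.≤ m → N ℕ.≤ n → seq x m ℚ.≤ seq x n ℚ.+ δ
  near m n N≤m N≤n = ∣p-q∣<ε⇒p≤q+ε (proj₂ (cauchy x δ 0<δ) m n N≤m N≤n)
  case : fromℚ p < x ⊎ x < fromℚ q
  case with ℚ.≤-total (p ℚ.+ (δ ℚ.+ δ)) (seq x N)
  ... | inj₁ ge = inj₁ (δ , 0<δ , N , λ n N≤n → begin
    p ℚ.+ δ                    ≡⟨ solve 2 (λ p δ → p :+ δ := p :+ (δ :+ δ) :- δ) refl p δ ⟩
    p ℚ.+ (δ ℚ.+ δ) ℚ.- δ      ≤⟨ ℚ.+-monoˡ-≤ (ℚ.- δ) (ℚ.≤-trans ge (near N n ℕ.≤-refl N≤n)) ⟩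
    seq x n ℚ.+ δ ℚ.- δ        ≡⟨ solve 2 (λ x δ → x :+ δ :- δ := x) refl (seq x n) δ ⟩
    seq x n                    ∎)
  ... | inj₂ le = inj₂ (δ , 0<δ , N , λ n N≤n → begin
    seq x n ℚ.+ δ                    ≤⟨ ℚ.+-monoˡ-≤ δ (near n N N≤n ℕ.≤-refl) ⟩
    seq x N ℚ.+ δ ℚ.+ δ              ≤⟨ ℚ.+-monoˡ-≤ δ (ℚ.+-monoˡ-≤ δ le) ⟩
    p ℚ.+ (δ ℚ.+ δ) ℚ.+ δ ℚ.+ δ      ≡⟨ solve 2 (λ p q → let δ = con (+ 1 / 4) :* (q :- p) in
                                          p :+ (δ :+ δ) :+ δ :+ δ := q) refl p q ⟩
    q                                ∎)

-- As `≤` is a negation, the argument is by contradiction: if `q < p`, cotransitivity puts `x` above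
-- `q` or below `p`, and each hypothesis excludes one of these.
fromℚ-≤-trans : ∀ {p q} x → fromℚ p ≤ x → x ≤ fromℚ q → p ℚ.≤ q
fromℚ-≤-trans x p≤x x≤q = ℚ.≮⇒≥ λ q<p → [ x≤q , p≤x ]′ (<-cotrans q<p x)

-- Rational grids of step 1 / (d + 1).

-- `mkℚᵘ` takes the denominator minus one. Order and sums of grid points are compared among
-- unnormalised rationals, so that no greatest common divisor enters.
point : ℕ → ℕ → ℚ
point d a = fromℚᵘ (mkℚᵘ (+ a) d)

point-mono-≤ : ∀ d {a b} → a ℕ.≤ b → point d a ℚ.≤ point d b
point-mono-≤ d {a} {b} a≤b = ℚ.toℚᵘ-cancel-≤ (begin
  toℚᵘ (point d a)  ≃⟨ ℚ.toℚᵘ-fromℚᵘ _ ⟩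
  mkℚᵘ (+ a) d      ≤⟨ ℚᵘ.*≤* (ℤ.*-monoʳ-≤-nonNeg (+ suc d) (ℤ.+≤+ a≤b)) ⟩
  mkℚᵘ (+ b) d      ≃⟨ ℚ.toℚᵘ-fromℚᵘ _ ⟨
  toℚᵘ (point d b)  ∎)
  where open ℚᵘ.≤-Reasoning

point-cancel-≤ : ∀ d {a b} → point d a ℚ.≤ point d b → a ℕ.≤ b
point-cancel-≤ d {a} {b} le = ℤ.drop‿+≤+ (ℤ.*-cancelʳ-≤-pos (+ a) (+ b) (+ suc d) (ℚᵘ.drop-*≤* (begin
  mkℚᵘ (+ a) d      ≃⟨ ℚ.toℚᵘ-fromℚᵘ _ ⟨
  toℚᵘ (point d a)  ≤⟨ ℚ.toℚᵘ-mono-≤ le ⟩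
  toℚᵘ (point d b)  ≃⟨ ℚ.toℚᵘ-fromℚᵘ _ ⟩
  mkℚᵘ (+ b) d      ∎)))
  where open ℚᵘ.≤-Reasoning

point-+-unit : ∀ d a → point d (a ℕ.+ suc d) ≡ point d a ℚ.+ 1ℚ
point-+-unit d a = ℚ.toℚᵘ-injective (begin-equality
  toℚᵘ (point d (a ℕ.+ suc d))      ≃⟨ ℚ.toℚᵘ-fromℚᵘ _ ⟩
  mkℚᵘ (+ (a ℕ.+ suc d)) d          ≃⟨ ℚᵘ.*≡* eq ⟩
  mkℚᵘ (+ a) d ℚᵘ.+ ℚᵘ.1ℚᵘ           ≃⟨ ℚᵘ.+-congˡ ℚᵘ.1ℚᵘ (ℚ.toℚᵘ-fromℚᵘ (mkℚᵘ (+ a) d)) ⟨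
  toℚᵘ (point d a) ℚᵘ.+ ℚᵘ.1ℚᵘ       ≃⟨ ℚ.toℚᵘ-homo-+ (point d a) 1ℚ ⟨
  toℚᵘ (point d a ℚ.+ 1ℚ)           ∎)
  where
  open ℚᵘ.≤-Reasoning
  eq : (+ (a ℕ.+ suc d)) ℤ.* (+ (suc d ℕ.* 1)) ≡ ((+ a) ℤ.* (+ 1) ℤ.+ (+ 1) ℤ.* (+ suc d)) ℤ.* (+ suc d)
  eq = trans (cong ((+ (a ℕ.+ suc d)) ℤ.*_) (cong +_ (ℕ.*-identityʳ (suc d))))
         (cong (ℤ._* (+ suc d)) (sym (cong₂ ℤ._+_ (ℤ.*-identityʳ (+ a)) (ℤ.*-identityˡ (+ suc d)))))

-- From seven colours against four to the bound 7/4.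

·-mono-≤ : ∀ {x y n} → seq x n ℚ.≤ seq y n → ∀ k → seq (k · x) n ℚ.≤ seq (k · y) n
·-mono-≤ le zero    = ℚ.≤-refl
·-mono-≤ le (suc k) = ℚ.+-mono-≤ le (·-mono-≤ le k)

-- Only five values of `k` occur, and each is decided by evaluation. Term 0 stands for the whole
-- sequence, because a multiple of a constant sequence is constant.
4·7/4≤7 : ∀ {k} → k ℕ.≤ 4 → seq (k · fromℚ (+ 7 / 4)) 0 ℚ.≤ + 7 / 1
4·7/4≤7 k≤4 = from-yes (ℕ.allUpTo? (λ k → seq (k · fromℚ (+ 7 / 4)) 0 ℚ.≤? + 7 / 1) 5) (s≤s k≤4)

-- If `q` were at most 7/4, the tail of `ρ` would stay `ε` below 7/4. Then at most four copies of
-- `ρ` would add up to strictly less than 7, contrary to 7 ≤ `m` and `m` ≤ `k · ρ`.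
ratio-bound : ∀ {ρ q m k} → ρ < fromℚ q → fromℕ m ≤ k · ρ → 7 ℕ.≤ m → k ℕ.≤ 4 → + 7 / 4 ℚ.< q
ratio-bound {ρ} {q} {m} {k} (ε , 0<ε , N , ρ+ε≤q) m≤kρ 7≤m k≤4 =
  ℚ.≰⇒> λ q≤7/4 → m≤kρ (kρ<m k k≤4 λ n N≤n → ℚ.≤-trans (ρ+ε≤q n N≤n) q≤7/4)
  where
  open ℚ.≤-Reasoning
  open +-*-Solver
  7≤m′ : + 7 / 1 ℚ.≤ + m / 1
  -- `point 0 m` is `+ m / 1` by definition.
  7≤m′ = point-mono-≤ 0 7≤m
  kρ<m : ∀ k → k ℕ.≤ 4 → (∀ n → N ℕ.≤ n → seq ρ n ℚ.+ ε ℚ.≤ + 7 / 4) → k · ρ < fromℕ m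
  -- The empty sum has no summand to supply the gap `ε`, so 0 < 7 settles it. In the next case the
  -- first summand supplies the gap, and the others need only the weak bound.
  kρ<m zero    _   _    = fromℚ-mono-< (ℚ.<-≤-trans (from-yes (0ℚ ℚ.<? + 7 / 1)) 7≤m′)
  kρ<m (suc k) k<4 ρ+ε≤ = ε , 0<ε , N , λ n N≤n → begin
    seq ρ n ℚ.+ seq (k · ρ) n ℚ.+ ε
      ≡⟨ solve 3 (λ r s e → r :+ s :+ e := (r :+ e) :+ s) refl (seq ρ n) (seq (k · ρ) n) ε ⟩
    seq ρ n ℚ.+ ε ℚ.+ seq (k · ρ) n
      ≤⟨ ℚ.+-mono-≤ (ρ+ε≤ n N≤n)
           (·-mono-≤ {ρ} {fromℚ (+ 7 / 4)} (ℚ.≤-trans (ℚ.<⇒≤ (p<p+ε 0<ε)) (ρ+ε≤ n N≤n)) k) ⟩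
    seq (suc k · fromℚ (+ 7 / 4)) n
      ≡⟨ const (suc k) n ⟩
    seq (suc k · fromℚ (+ 7 / 4)) 0
      ≤⟨ 4·7/4≤7 k<4 ⟩
    + 7 / 1
      ≤⟨ 7≤m′ ⟩
    + m / 1 ∎
    where
    const : ∀ k n → seq (k · fromℚ (+ 7 / 4)) n ≡ seq (k · fromℚ (+ 7 / 4)) 0
    const zero    n = refl
    const (suc k) n = cong (+ 7 / 4 ℚ.+_) (const k n)

-- Integer intervals and their intersection graphs.

-- Storing the extent instead of the right end makes `start` ≤ `end` hold by construction.
record Span : Set where
  constructor span
  field
    start extent : ℕ

  end : ℕ
  end = start ℕ.+ extent

open Span

Overlap : Rel Span 0ℓ
Overlap I J = start I ℕ.≤ end J × start J ℕ.≤ end I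

-- A single Boolean test, as overlap? and leftOf? are evaluated many thousand times.
overlap? : Decidable Overlap
overlap? I J = map′ (Product.map (ℕ.≤ᵇ⇒≤ _ _) (ℕ.≤ᵇ⇒≤ _ _) ∘ Equivalence.to T-∧)
                    (Equivalence.from T-∧ ∘ Product.map ℕ.≤⇒≤ᵇ ℕ.≤⇒≤ᵇ)
                    (T? ((start I ≤ᵇ end J) ∧ (start J ≤ᵇ end I)))

LeftOf : Rel Span 0ℓ
LeftOf I J = start I ℕ.< start J × end I ℕ.< end J

leftOf? : Decidable LeftOf
leftOf? I J = map′ (Product.map (ℕ.<ᵇ⇒< _ _) (ℕ.<ᵇ⇒< _ _) ∘ Equivalence.to T-∧)
                   (Equivalence.from T-∧ ∘ Product.map ℕ.<⇒<ᵇ ℕ.<⇒<ᵇ)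
                   (T? ((start I <ᵇ start J) ∧ (end I <ᵇ end J)))

-- The coordinates count multiples of 1 / (d + 1), so that a span of extent d + 1
-- becomes a unit interval.
interval : ℕ → Span → Interval
interval d I = record
  { lo    = fromℚ (point d (start I))
  ; hi    = fromℚ (point d (end I))
  ; lo≤hi = fromℚ-mono-≤ (point-mono-≤ d {start I} (ℕ.m≤m+n (start I) (extent I)))
  }

module _ (d : ℕ) where

  point-≤ : ∀ {a b} → a ℕ.≤ b → fromℚ (point d a) ≤ fromℚ (point d b)
  point-≤ = fromℚ-mono-≤ ∘ point-mono-≤ d

  ≤-point : ∀ {a b} → fromℚ (point d a) ≤ fromℚ (point d b) → a ℕ.≤ b
  ≤-point = point-cancel-≤ d ∘ fromℚ-cancel-≤

  lo∈ : ∀ I → lo (interval d I) ∈ᵘ ⟦ interval d I ⟧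
  lo∈ I = point-≤ (ℕ.≤-refl {start I}) , lo≤hi (interval d I)

  hi∈ : ∀ I → hi (interval d I) ∈ᵘ ⟦ interval d I ⟧
  hi∈ I = lo≤hi (interval d I) , point-≤ (ℕ.≤-refl {end I})

  -- Overlapping intervals share the larger of their left ends. Conversely, the common point is an
  -- arbitrary Cauchy real, so the endpoints are compared through it by `fromℚ-≤-trans`.
  overlap⇔≬ : ∀ I J → Overlap I J ⇔ ⟦ interval d I ⟧ ≬ ⟦ interval d J ⟧
  overlap⇔≬ I J = mk⇔ to from
    where
    to : Overlap I J → ⟦ interval d I ⟧ ≬ ⟦ interval d J ⟧
    to (I≤J , J≤I) with ℕ.≤-total (start I) (start J)
    ... | inj₁ i≤j = lo (interval d J) , (point-≤ i≤j , point-≤ J≤I) , lo∈ J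
    ... | inj₂ j≤i = lo (interval d I) , lo∈ I , (point-≤ j≤i , point-≤ I≤J)
    from : ⟦ interval d I ⟧ ≬ ⟦ interval d J ⟧ → Overlap I J
    from (x , (i≤x , x≤i) , (j≤x , x≤j)) =
      point-cancel-≤ d (fromℚ-≤-trans x i≤x x≤j) , point-cancel-≤ d (fromℚ-≤-trans x j≤x x≤i)

graph : List Span → Graph
graph L = record
  { order    = length L
  ; _~_      = λ u v → u ≢ v × Overlap (lookup L u) (lookup L v)
  ; _~?_     = λ u v → ¬? (u Fin.≟ v) ×-dec overlap? (lookup L u) (lookup L v)
  ; ~-sym    = λ (u≢v , o) → u≢v ∘ sym , swap o
  ; ~-irrefl = λ (v≢v , _) → v≢v refl
  }

-- Certificates for properness, a unit representation and a 4-colouring.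

-- `spot` is the span as presented. `unit` is the left end, on the grid of step 1 / (d + 1), of the
-- unit interval that represents the same vertex, and `colour` is its colour in a 4-colouring.
record Place : Set where
  constructor place
  field
    spot   : Span
    unit   : ℕ
    colour : Fin 4

open Place

unitSpan : ℕ → Place → Span
unitSpan d p = span (unit p) (suc d)

-- The first component makes the presented spans incomparable under inclusion. The other two say
-- that spans and unit intervals define the same adjacency and that neighbours differ in colour.
Compatible : ℕ → Rel Place 0ℓ
Compatible d p q =
  (LeftOf (spot p) (spot q) ⊎ LeftOf (spot q) (spot p)) ×
  (Overlap (spot p) (spot q) → Overlap (unitSpan d p) (unitSpan d q) × colour p ≢ colour q) ×
  (Overlap (unitSpan d p) (unitSpan d q) → Overlap (spot p) (spot q))

compatible? : ∀ d → Decidable (Compatible d)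
compatible? d p q =
  (leftOf? (spot p) (spot q) ⊎-dec leftOf? (spot q) (spot p)) ×-dec
  (overlap? (spot p) (spot q) →-dec
    (overlap? (unitSpan d p) (unitSpan d q) ×-dec ¬? (colour p Fin.≟ colour q))) ×-dec
  (overlap? (unitSpan d p) (unitSpan d q) →-dec overlap? (spot p) (spot q))

compatible-sym : ∀ {d} → Symmetric (Compatible d)
compatible-sym (l , o , u) =
  Sum.swap l , (λ x → let y , c = o (swap x) in swap y , c ∘ sym) , swap ∘ u ∘ swap

-- The certificate `locate` depends on the span and not on its position in `L`, so the same function
-- certifies every prefix of `L`.
record Realisable (L : List Span) : Set where
  constructor realisable
  field
    {denominator-1} : ℕ
    {locate}        : Span → Place
    spot-locate     : ∀ I → spot (locate I) ≡ I
    pairs           : AllPairs (Compatible denominator-1 on locate) L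

AllPairs-lookup : ∀ {A : Set} {R : Rel A 0ℓ} → Symmetric R → ∀ {xs} → AllPairs R xs →
                  ∀ {i j} → i ≢ j → R (lookup xs i) (lookup xs j)
AllPairs-lookup R-sym (_  ∷ _)  {zero}  {zero}  i≢j = contradiction refl i≢j
AllPairs-lookup R-sym (rs ∷ _)  {zero}  {suc j} _   = All.lookup rs (∈-lookup j)
AllPairs-lookup R-sym (rs ∷ _)  {suc i} {zero}  _   = R-sym (All.lookup rs (∈-lookup i))
AllPairs-lookup R-sym (_  ∷ ps) {suc i} {suc j} i≢j = AllPairs-lookup R-sym ps (i≢j ∘ cong suc)

module _ {L : List Span} (r : Realisable L) where
  open Realisable r renaming (denominator-1 to d)

  private
    spanOf : Fin (length L) → Span
    spanOf = lookup L

    placeOf : Fin (length L) → Place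
    placeOf = locate ∘ spanOf

    compatible : ∀ {u v} → u ≢ v →
      (LeftOf (spanOf u) (spanOf v) ⊎ LeftOf (spanOf v) (spanOf u)) ×
      (Overlap (spanOf u) (spanOf v) →
        Overlap (unitSpan d (placeOf u)) (unitSpan d (placeOf v)) ×
        colour (placeOf u) ≢ colour (placeOf v)) ×
      (Overlap (unitSpan d (placeOf u)) (unitSpan d (placeOf v)) → Overlap (spanOf u) (spanOf v))
    compatible {u} {v} u≢v
      with p ← AllPairs-lookup compatible-sym pairs u≢v
      rewrite spot-locate (spanOf u) | spot-locate (spanOf v) = p

  presentation : Presentation (graph L)
  presentation = record
    -- Denominator 1: the vertices are presented with the integer endpoints of their spans, not with
    -- the unit intervals.
    { rep      = interval 0 ∘ spanOf
    ; isProper = isRepresentation , incomparable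
    ; arrival  = Permutation.id
    }
    where
    isRepresentation : IsRepresentation (graph L) (interval 0 ∘ spanOf)
    isRepresentation {u} {v} u≢v = mk⇔ (to ∘ proj₂) (λ m → u≢v , from m)
      where open Equivalence (overlap⇔≬ 0 (spanOf u) (spanOf v))

    incomparable : ∀ u v → ¬ (⟦ interval 0 (spanOf u) ⟧ ⊂ ⟦ interval 0 (spanOf v) ⟧)
    incomparable u v (u⊆v , u⊉v) with u Fin.≟ v
    ... | yes refl = u⊉v (λ x → x)
    ... | no u≢v with proj₁ (compatible u≢v)
    ...   | inj₁ (u<v , _) = ℕ.<⇒≱ u<v (≤-point 0 {start (spanOf v)}
                               (proj₁ (u⊆v {lo (interval 0 (spanOf u))} (lo∈ 0 (spanOf u)))))
    ...   | inj₂ (_ , v<u) = ℕ.<⇒≱ v<u (≤-point 0 {end (spanOf u)}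
                               (proj₂ (u⊆v {hi (interval 0 (spanOf u))} (hi∈ 0 (spanOf u)))))

  isUnitIntervalGraph : IsUnitIntervalGraph (graph L)
  isUnitIntervalGraph = rep , isRepresentation , unitLength
    where
    rep : Fin (length L) → Interval
    rep = interval d ∘ unitSpan d ∘ placeOf

    isRepresentation : IsRepresentation (graph L) rep
    isRepresentation {u} {v} u≢v =
      let _ , unit⁺ , unit⁻ = compatible u≢v
      in mk⇔ (to ∘ proj₁ ∘ unit⁺ ∘ proj₂) (λ m → u≢v , unit⁻ (from m))
      where open Equivalence (overlap⇔≬ d (unitSpan d (placeOf u)) (unitSpan d (placeOf v)))

    unitLength : ∀ v → hi (rep v) ≈ lo (rep v) + fromℚ 1ℚ
    unitLength v = fromℚ-mono-≤ (ℚ.≤-reflexive length≡1) , fromℚ-mono-≤ (ℚ.≤-reflexive (sym length≡1))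
      where length≡1 = point-+-unit d (unit (placeOf v))

  4-colourable : Colourable (graph L) 4
  4-colourable = colour ∘ placeOf , λ (u≢v , o) → proj₂ (proj₁ (proj₂ (compatible u≢v)) o)

-- Greedy construction of unit representations.

-- When no span contains another, sorting by left ends also sorts by right ends, which gives the
-- left-to-right order needed by the layout.
insert : Span → List Span → List Span
insert I []       = I ∷ []
insert I (J ∷ Js) = if start I ≤ᵇ start J then I ∷ J ∷ Js else J ∷ insert I Js

-- Intervals are placed from left to right: each new unit interval starts halfway
-- between the bounds imposed by those already placed, and four consecutive
-- intervals get distinct colours.  Success is not proved but checked by realised?.
-- The functions ⊔′, ⊓′ and / are used because they evaluate by built-in arithmetic.
module _ (d : ℕ) where

  lower : Span → List Place → ℕ
  lower I = foldr (λ p l → l ⊔′ (if does (overlap? I (spot p)) then unit p else end (unitSpan d p))) 0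

  upper : Span → ℕ → List Place → ℕ
  upper I = foldr (λ p u → if does (overlap? I (spot p)) then u ⊓′ end (unitSpan d p) else u)

  placeNext : List Place → Span → List Place
  placeNext ps I =
    -- The cap `l + suc d` takes effect only if no placed span overlaps `I`: an overlapping one has
    -- its unit interval start at or before `l`, and hence end at or before the cap.
    let l = lower I ps in place I ((l ℕ.+ upper I (l ℕ.+ suc d) ps) ℕ./ 2) (length ps mod 4) ∷ ps

  layout : List Span → List Place
  layout = foldl placeNext [] ∘ foldr insert []

-- Left ends serve as keys, since compatible spans have different ones. The result carries `I`
-- itself as its spot, so `spot-find` holds unconditionally. The default in the first clause is a
-- filler: `realised?` looks up only spans that were laid out.
find : List Place → Span → Place
find []                 I = place I 0 zero
find (place J x c ∷ ps) I = if start I ≡ᵇ start J then place I x c else find ps I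

spot-find : ∀ ps I → spot (find ps I) ≡ I
spot-find []                 I = refl
spot-find (place J x c ∷ ps) I with start I ≡ᵇ start J
... | true  = refl
... | false = spot-find ps I

realised? : ∀ d L → Dec (AllPairs (Compatible d) (map (find (layout d L)) L))
realised? d L = allPairs? (compatible? d) (map (find (layout d L)) L)

realised⇒realisable : ∀ d {L} → True (realised? d L) → Realisable L
realised⇒realisable d {L} t =
  realisable (spot-find (layout d L)) (AllPairs.map⁻ (toWitness {a? = realised? d L} t))

-- The tree of the adversary and its evaluation.

data Tree : Set where
  node : (start extent : ℕ) → List Tree → Tree

root : Tree → Span
root (node s e _) = span s e

-- wins d L cs t: after the intervals L, with colour classes cs, the adversary forces a
-- seventh colour by presenting the interval at the root of t.  The subtrees are
-- for the replies that reuse a class without a neighbour of that interval, in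
-- the order of the classes, and then for a new colour if fewer than six are in use.
-- Realisability is inherited by prefixes and hence tested at the leaves only.
module _ (d : ℕ) where

  mutual
    wins : List Span → List (List Span) → Tree → Bool
    wins L cs (node s e [])         = isYes (realised? d (L ∷ʳ span s e)) ∧
                                      answered (L ∷ʳ span s e) (span s e) [] cs []
    wins L cs (node s e ts@(_ ∷ _)) = answered (L ∷ʳ span s e) (span s e) [] cs ts

    answered : List Span → Span → List (List Span) → List (List Span) → List Tree → Bool
    answered L I bs []       []       = 6 ≤ᵇ length bs
    answered L I bs []       (t ∷ _)  = wins L (bs ∷ʳ [ I ]) t
    answered L I bs (c ∷ cs) []       = isYes (any? (overlap? I) c) ∧ answered L I (bs ∷ʳ c) cs []
    answered L I bs (c ∷ cs) (t ∷ ts) =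
      if isYes (any? (overlap? I) c)
      then answered L I (bs ∷ʳ c) cs (t ∷ ts)
      else wins L (bs ++ (I ∷ c) ∷ cs) t ∧ answered L I (bs ∷ʳ c) cs ts

-- Prefixes and counting in lists.

AllPairs-∷ʳ⁻ : ∀ {A : Set} {R : A → A → Set} xs {y} →
               AllPairs R (xs ∷ʳ y) → AllPairs R xs × All (λ x → R x y) xs
AllPairs-∷ʳ⁻ []       _        = [] , []
AllPairs-∷ʳ⁻ (x ∷ xs) (r ∷ rs) =
  let rx , rxy = All.∷ʳ⁻ r ; ps , qs = AllPairs-∷ʳ⁻ xs rs in rx ∷ ps , rxy ∷ qs

-- Pigeonhole: removing the head of `xs` from `ys` shortens `ys` by one and keeps the tail of `xs`
-- inside, because the head does not recur there.
Unique-⊆-length : ∀ {A : Set} {xs ys : List A} → Unique xs → All (_∈ ys) xs → length xs ℕ.≤ length ys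
Unique-⊆-length []            []             = z≤n
Unique-⊆-length {xs = x ∷ xs} (x∉xs ∷ uniq) (x∈ys ∷ xs⊆ys) with ∈-∃++ x∈ys
... | us , vs , refl = begin
  suc (length xs)               ≤⟨ s≤s (Unique-⊆-length uniq
                                     (All.zipWith (Product.uncurry remove) (x∉xs , xs⊆ys))) ⟩
  suc (length (us ++ vs))       ≡⟨ cong suc (List.length-++ us) ⟩
  suc (length us ℕ.+ length vs) ≡⟨ ℕ.+-suc (length us) (length vs) ⟨
  length us ℕ.+ suc (length vs) ≡⟨ List.length-++ us ⟨
  length (us ++ x ∷ vs)         ∎
  where
  open ℕ.≤-Reasoning
  remove : ∀ {y} → x ≢ y → y ∈ us ++ x ∷ vs → y ∈ us ++ vs
  remove x≢y y∈ with ∈-++⁻ us y∈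
  ... | inj₁ y∈us         = ∈-++⁺ˡ y∈us
  ... | inj₂ (here y≡x)   = contradiction (sym y≡x) x≢y
  ... | inj₂ (there y∈vs) = ∈-++⁺ʳ us y∈vs

realisable-∷ʳ⁻ : ∀ L {I} → Realisable (L ∷ʳ I) → Realisable L
realisable-∷ʳ⁻ L (realisable spot≡ pairs) = realisable spot≡ (proj₁ (AllPairs-∷ʳ⁻ L pairs))

-- Transcripts of a play.

Clash : Rel (Span × ℕ) 0ℓ
Clash (I , x) (J , y) = Overlap I J → x ≢ y

module History (reply : List (Span × ℕ) → Span → ℕ) where

  replay : List (Span × ℕ) → List Span → List (Span × ℕ)
  replay h []      = h
  replay h (I ∷ L) = replay (h ∷ʳ (I , reply h I)) L

  history : List Span → List (Span × ℕ)
  history = replay []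

  -- `replay` consumes spans from the front, as `run` does, while a play grows at the end. This
  -- equation exposes the latest reply; the induction needs an arbitrary past `h`.
  history-∷ʳ : ∀ L I → history (L ∷ʳ I) ≡ history L ∷ʳ (I , reply (history L) I)
  history-∷ʳ L I = go [] L
    where
    go : ∀ h L → replay h (L ∷ʳ I) ≡ replay h L ∷ʳ (I , reply (replay h L) I)
    go h []      = refl
    go h (J ∷ L) = go (h ∷ʳ (J , reply h J)) L

-- The replies are a parameter, and not those of an algorithm given real intervals,
-- because otherwise with-abstraction would normalise Cauchy sequences.
module Game (d : ℕ) (reply : List (Span × ℕ) → Span → ℕ)
            (proper : ∀ {L} → Realisable L → AllPairs Clash (History.history reply L)) where

  open History reply

  -- Colour classes as the invariant of a play.

  record SevenColours : Set where
    field
      {spans}    : List Span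
      realised   : Realisable spans
      {colours′} : List ℕ
      unique     : Unique colours′
      used       : All (_∈ map proj₂ (history spans)) colours′
      seven      : 7 ℕ.≤ length colours′

  -- Membership is recorded in one direction, from the class to the transcript: a neighbour found in
  -- `c` then excludes the colour `x`.
  Class : List Span → ℕ → List Span → Set
  Class L x c = All (λ J → (J , x) ∈ history L) c

  record Classes (L : List Span) (xs : List ℕ) (cs : List (List Span)) : Set where
    constructor classes
    field
      unique  : Unique xs
      used    : All (_∈ map proj₂ (history L)) xs
      members : Pointwise (Class L) xs cs

  -- Soundness of the evaluated tree.

  mutual
    -- Legality of the replies is available only for realisable positions, so realisability has to
    -- follow from the evaluated Boolean alone, before any reply is inspected. Descending through
    -- the first subtree of each node reaches a leaf, whose test covers all its prefixes.
    wins⇒realisable : ∀ L cs t → T (wins d L cs t) → Realisable (L ∷ʳ root t)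
    wins⇒realisable L cs (node s e [])       w = realised⇒realisable d (proj₁ (Equivalence.to T-∧ w))
    wins⇒realisable L cs (node s e (t ∷ ts)) w =
      answered⇒realisable (L ∷ʳ span s e) (span s e) [] cs t ts w

    answered⇒realisable : ∀ L I bs cs t ts → T (answered d L I bs cs (t ∷ ts)) → Realisable L
    answered⇒realisable L I bs []       t ts w = realisable-∷ʳ⁻ L (wins⇒realisable L _ t w)
    answered⇒realisable L I bs (c ∷ cs) t ts w with isYes (any? (overlap? I) c)
    ... | true  = answered⇒realisable L I (bs ∷ʳ c) cs t ts w
    ... | false = realisable-∷ʳ⁻ L (wins⇒realisable L _ t (proj₁ (Equivalence.to T-∧ w)))

  module _ (L : List Span) (I : Span) where

    private
      x : ℕ
      x = reply (history L) I

    old : ∀ {p} → p ∈ history L → p ∈ history (L ∷ʳ I)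
    old p∈ = subst (_ ∈_) (sym (history-∷ʳ L I)) (∈-++⁺ˡ p∈)

    new : (I , x) ∈ history (L ∷ʳ I)
    new = subst ((I , x) ∈_) (sym (history-∷ʳ L I)) (∈-++⁺ʳ (history L) (here refl))

    old-used : ∀ {y} → y ∈ map proj₂ (history L) → y ∈ map proj₂ (history (L ∷ʳ I))
    old-used y∈ with ∈-map⁻ proj₂ y∈
    ... | _ , p∈ , refl = ∈-map⁺ proj₂ (old p∈)

    -- Legality is applied to the position after the reply: the last entry of its transcript must
    -- differ in colour from every earlier span that it overlaps.
    blocked : Realisable (L ∷ʳ I) → ∀ {y c} → Class L y c → Any (Overlap I) c → y ≢ x
    blocked r class any =
      let J∈ , o = All.lookupAny class any
          before = AllPairs-∷ʳ⁻ (history L) (subst (AllPairs Clash) (history-∷ʳ L I) (proper r))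
      in All.lookup (proj₂ before) J∈ (swap o)

  -- A traversal of the colour classes: those in bs, with the colours ys, are known
  -- not to receive I; those in cs, with the colours zs, are still to be examined.
  record Scan (L : List Span) (I : Span) (ys zs : List ℕ) (bs cs : List (List Span)) : Set where
    constructor scan
    field
      unique : Unique (ys ++ zs)
      used   : All (_∈ map proj₂ (history L)) (ys ++ zs)
      before : Pointwise (Class L) ys bs
      after  : Pointwise (Class L) zs cs
      fresh  : All (_≢ reply (history L) I) ys

  start-scan : ∀ {L I xs cs} → Classes L xs cs → Scan L I [] xs [] cs
  start-scan (classes unique used members) = scan unique used [] members []

  skip : ∀ {L I ys z zs bs c cs} → z ≢ reply (history L) I →
         Scan L I ys (z ∷ zs) bs (c ∷ cs) → Scan L I (ys ∷ʳ z) zs (bs ∷ʳ c) cs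
  skip {ys = ys} {z} {zs} z≢x (scan unique used before (p ∷ after) fresh) = scan
    (subst Unique (sym (List.∷ʳ-++ ys z zs)) unique)
    (subst (All _) (sym (List.∷ʳ-++ ys z zs)) used)
    (Pointwise.++⁺ before (p ∷ [])) after (All.∷ʳ⁺ fresh z≢x)

  skip-blocked : ∀ {L I ys z zs bs c cs} → Realisable (L ∷ʳ I) → Any (Overlap I) c →
                 Scan L I ys (z ∷ zs) bs (c ∷ cs) → Scan L I (ys ∷ʳ z) zs (bs ∷ʳ c) cs
  skip-blocked {L} {I} r o S@(scan _ _ _ (p ∷ _) _) = skip (blocked L I r p o) S

  reuse : ∀ {L I ys zs bs c cs} → Scan L I ys (reply (history L) I ∷ zs) bs (c ∷ cs) →
          Classes (L ∷ʳ I) (ys ++ reply (history L) I ∷ zs) (bs ++ (I ∷ c) ∷ cs)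
  reuse {L} {I} (scan unique used before (p ∷ after) _) = classes unique
    (All.map (old-used L I) used)
    (Pointwise.++⁺ (Pointwise.map (All.map (old L I)) before)
      ((new L I ∷ All.map (old L I) p) ∷ Pointwise.map (All.map (old L I)) after))

  add-new : ∀ {L I ys bs} → Scan L I ys [] bs [] →
            Classes (L ∷ʳ I) (ys ∷ʳ reply (history L) I) (bs ∷ʳ [ I ])
  add-new {L} {I} {ys} (scan unique used before [] fresh) = classes
    (AllPairs.++⁺ (subst Unique (List.++-identityʳ ys) unique) ([] ∷ []) (All.map (_∷ []) fresh))
    (All.∷ʳ⁺ (All.map (old-used L I) (subst (All _) (List.++-identityʳ ys) used))
             (∈-map⁺ proj₂ (new L I)))
    (Pointwise.++⁺ (Pointwise.map (All.map (old L I)) before) ((new L I ∷ []) ∷ []))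

  mutual
    -- The invariant `Classes` is carried along the one branch selected by the replies. The
    -- recursion is structural in the tree, so the play stops, and it stops only at a reply with a
    -- seventh colour.
    wins⇒seven : ∀ {L cs xs} t → Classes L xs cs → T (wins d L cs t) → SevenColours
    wins⇒seven {L} {cs} t@(node s e []) C w =
      none⇒seven (wins⇒realisable L cs t w) (start-scan C) (proj₂ (Equivalence.to T-∧ w))
    wins⇒seven {L} {cs} t@(node s e (u ∷ us)) C w =
      some⇒seven u us (wins⇒realisable L cs t w) (start-scan C) w

    -- With no subtree left, every class still to be examined contains a neighbour of `I`. The reply
    -- is therefore outside all classes, of which there are at least six. This arises at leaves and
    -- also at inner nodes, once the reply has passed over the last subtree.
    none⇒seven : ∀ {L I ys zs bs cs} → Realisable (L ∷ʳ I) → Scan L I ys zs bs cs →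
                 T (answered d (L ∷ʳ I) I bs cs []) → SevenColours
    none⇒seven {ys = ys} {cs = []} r S@(scan _ _ before [] _) w = record
      { realised = r
      ; unique   = Classes.unique (add-new S)
      ; used     = Classes.used (add-new S)
      ; seven    = subst (7 ℕ.≤_) (sym (trans (List.length-++ ys) (ℕ.+-comm (length ys) 1)))
                     (s≤s (subst (6 ℕ.≤_) (sym (Pointwise.Pointwise-length before)) (ℕ.≤ᵇ⇒≤ 6 _ w)))
      }
    none⇒seven {I = I} {cs = c ∷ cs} r S@(scan _ _ _ (_ ∷ _) _) w =
      let o , w′ = Equivalence.to T-∧ w
      in none⇒seven r (skip-blocked r (toWitness {a? = any? (overlap? I) c} o) S) w′

    some⇒seven : ∀ {L I ys zs bs cs} t ts → Realisable (L ∷ʳ I) → Scan L I ys zs bs cs →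
                 T (answered d (L ∷ʳ I) I bs cs (t ∷ ts)) → SevenColours
    some⇒seven {cs = []} t ts r S@(scan _ _ _ [] _) w = wins⇒seven t (add-new S) w
    some⇒seven {L} {I} {zs = z ∷ _} {cs = c ∷ cs} t ts r S@(scan _ _ _ (_ ∷ _) _) w
      -- Splitting on the test made by `answered` lets the conditional in the type of `w` reduce.
      with any? (overlap? I) c
    ... | yes o = some⇒seven t ts r (skip-blocked r o S) w
    -- `z` is the colour of `c`. If the reply equals it, the play continues in `t`; otherwise `c`
    -- and `t` are passed over together, and the form of `ts` decides whether `answered` still
    -- expects a subtree.
    ... | no _ with z ℕ.≟ reply (history L) I | ts
    ...   | yes refl | _      = wins⇒seven t (reuse S) (proj₁ (Equivalence.to T-∧ w))
    ...   | no z≢x   | []     = none⇒seven r (skip z≢x S) (proj₂ (Equivalence.to T-∧ w))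
    ...   | no z≢x   | u ∷ us = some⇒seven u us r (skip z≢x S) (proj₂ (Equivalence.to T-∧ w))

-- The run of the algorithm as a transcript.

module Replies (A : OnlineAlgorithm) where

  reply : List (Span × ℕ) → Span → ℕ
  reply h I = strategy A (map (map₁ (interval 0)) h) (interval 0 I)

  open History reply public

  -- Both recursions append to the past, so the induction is over an arbitrary `h`. The two pasts
  -- stay equal because translating spans into intervals commutes with appending.
  replay-run : ∀ h L →
    replay h L ≡ h ++ tabulate λ i →
      lookup L i ,
      Vec.lookup (run (strategy A) (map (map₁ (interval 0)) h) (Vec.tabulate (interval 0 ∘ lookup L))) i
  replay-run h []      = sym (List.++-identityʳ h)
  replay-run h (I ∷ L) = trans (replay-run (h ∷ʳ (I , reply h I)) L) (begin
    (h ∷ʳ (I , reply h I)) ++ rest (map (map₁ (interval 0)) (h ∷ʳ (I , reply h I)))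
      ≡⟨ cong (λ past → (h ∷ʳ (I , reply h I)) ++ rest past) (List.map-++ (map₁ (interval 0)) h _) ⟩
    (h ∷ʳ (I , reply h I)) ++ rest (map (map₁ (interval 0)) h ∷ʳ (interval 0 I , reply h I))
      ≡⟨ List.++-assoc h _ _ ⟩
    h ++ (I , reply h I) ∷ rest (map (map₁ (interval 0)) h ∷ʳ (interval 0 I , reply h I)) ∎)
    where
    open ≡-Reasoning
    rest : List (Interval × ℕ) → List (Span × ℕ)
    rest past = tabulate λ i →
      lookup L i , Vec.lookup (run (strategy A) past (Vec.tabulate (interval 0 ∘ lookup L))) i

  module _ {L : List Span} (r : Realisable L) where

    history-colouring : history L ≡ tabulate λ i → lookup L i , colouring (strategy A) (presentation r) i
    history-colouring = replay-run [] L

    -- Legality of `A` enters here. It applies because the certificate yields a unit representation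
    -- of the graph as well as the proper presentation being played.
    history-proper : AllPairs Clash (history L)
    history-proper = subst (AllPairs Clash) (sym history-colouring)
      (AllPairs.tabulate⁺ λ i≢j o → legal A (isUnitIntervalGraph r) (presentation r) (i≢j , o))

    history⊆colours : ∀ {x} → x ∈ map proj₂ (history L) →
                      x ∈ Vec.toList (colours (strategy A) (presentation r))
    history⊆colours x∈ with ∈-map⁻ proj₂ (subst (λ h → _ ∈ map proj₂ h) history-colouring x∈)
    ... | _ , p∈ , refl with ∈-tabulate⁻ p∈
    ...   | i , refl = Vec.∈-toList⁺ (Vec.∈-lookup i (colours (strategy A) (presentation r)))

    length≤coloursUsed : ∀ {xs} → Unique xs → All (_∈ map proj₂ (history L)) xs →
                         length xs ℕ.≤ coloursUsed (strategy A) (presentation r)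
    length≤coloursUsed uniq xs⊆ =
      Unique-⊆-length uniq (All.map (∈-deduplicate⁺ ℕ._≟_ ∘ history⊆colours) xs⊆)

-- Chromatic numbers up to double negation.

-- `P` need not be decidable, so its least element cannot be searched for. If there were none,
-- strong induction would refute `P` at every number.
¬¬-least : ∀ {ℓ} {P : ℕ → Set ℓ} n → P n → ¬ ¬ (∃ λ k → P k × (∀ j → P j → k ℕ.≤ j))
¬¬-least {P = P} n pn none = <-rec (λ n → ¬ P n)
  (λ n smaller pn → none (n , pn , λ j pj → ℕ.≮⇒≥ λ j<n → smaller j<n pj)) n pn

coloursUsed≤order : ∀ s {G} (P : Presentation G) → coloursUsed s P ℕ.≤ Graph.order G
coloursUsed≤order s P = subst (coloursUsed s P ℕ.≤_) (Vec.length-toList (colours s P))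
  (List.length-deduplicate ℕ._≟_ (Vec.toList (colours s P)))

-- The maximum is obtained as a minimum, that of the order minus the number of colours used.
¬¬-onlineChromaticNumber : ∀ A {G} (P : Presentation G) →
  ¬ ¬ (∃ λ m → coloursUsed (strategy A) P ℕ.≤ m × IsOnlineChromaticNumber A G m)
¬¬-onlineChromaticNumber A {G} P none =
  ¬¬-least {P = λ k → ∃ λ (Q : Presentation G) → unused Q ≡ k} (unused P) (P , refl)
    λ { (_ , (Q , refl) , least) →
      let most : ∀ R → coloursUsed (strategy A) R ℕ.≤ coloursUsed (strategy A) Q
          -- Truncated subtraction can be cancelled because no presentation uses more colours than
          -- there are vertices.
          most R = ℕ.∸-cancelʳ-≤ (coloursUsed≤order (strategy A) R) (least (unused R) (R , refl))
      in none (coloursUsed (strategy A) Q , most P , (Q , refl) , most) }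
  where
  unused : Presentation G → ℕ
  unused Q = Graph.order G ℕ.∸ coloursUsed (strategy A) Q

-- The winning tree and the competitive ratio.

abstract
  -- Found by proof-number search.  At most 18 intervals are presented, so the unit
  -- length 2 ^ 20 leaves room for the successive halvings in the layout.
  winning-tree : ∃ λ t → T (wins 1048575 [] [] t)
  winning-tree = (
    node 41 20 [ node 9 17 (node 4 11 [ node 34 11 (node 14 19 [ node 29 14 [ node 0 11 (node 1 12
    (node 27 15 [ node 12 16 [ node 16 19 [] ] ] ∷ node 31 13 (node 12 18 [ node 16 19 [] ] ∷ node
    12 20 [] ∷ []) ∷ []) ∷ node 27 15 [ node 10 18 [ node 16 19 [] ] ] ∷ node 31 13 (node 10 20 [
    node 16 19 [] ] ∷ node 10 22 [] ∷ []) ∷ []) ] ] ∷ node 22 18 (node 6 13 (node 29 14 [ node 5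
    12 (node 27 15 [ node 16 12 [ node 18 12 [] ] ] ∷ node 31 13 (node 16 14 [ node 18 14 [] ] ∷
    node 16 16 [] ∷ []) ∷ []) ] ∷ node 7 14 (node 29 14 (node 27 15 [ node 16 12 [ node 20 10 [] ]
    ] ∷ node 31 13 (node 16 14 [ node 20 12 [] ] ∷ node 16 16 [] ∷ []) ∷ []) ∷ node 38 9 (node 16
    19 [ node 20 19 [] ] ∷ node 36 10 (node 16 19 [ node 20 17 [] ] ∷ node 16 21 [] ∷ []) ∷ node
    16 23 [] ∷ []) ∷ []) ∷ []) ∷ node 2 9 (node 38 9 (node 10 18 [ node 27 15 [ node 12 23 [] ] ]
    ∷ node 0 6 (node 1 7 (node 12 23 (node 36 10 (node 7 10 [ node 16 21 [] ] ∷ node 13 24 [] ∷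
    []) ∷ node 13 26 [] ∷ []) ∷ node 12 27 [ node 7 16 [] ] ∷ node 12 23 (node 7 16 [] ∷ node 13
    26 [] ∷ []) ∷ []) ∷ node 3 10 (node 14 25 [ node 12 23 [] ] ∷ node 12 27 [] ∷ []) ∷ node 12 27
    [ node 5 18 [] ] ∷ node 12 23 (node 5 18 [] ∷ node 13 26 [] ∷ []) ∷ []) ∷ []) ∷ node 5 12
    (node 29 14 (node 27 15 [ node 12 16 [ node 16 14 [] ] ] ∷ node 31 13 (node 12 18 [ node 16 16
    [] ] ∷ node 12 20 [] ∷ []) ∷ []) ∷ node 38 9 (node 12 23 [ node 16 23 [] ] ∷ node 36 10 (node
    12 23 [ node 16 21 [] ] ∷ node 12 25 [] ∷ []) ∷ node 12 27 [] ∷ []) ∷ []) ∷ node 38 9 (node 36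
    10 (node 10 25 [ node 12 25 [] ] ∷ node 10 27 [] ∷ []) ∷ node 10 25 [ node 12 27 [] ] ∷ node
    10 29 [] ∷ []) ∷ []) ∷ []) ∷ []) ] ∷ node 2 14 (node 50 16 (node 14 19 [ node 29 23 [ node 0
    11 (node 1 12 (node 27 24 [ node 12 16 [ node 17 25 [] ] ] ∷ node 31 22 (node 12 18 [ node 17
    25 [] ] ∷ node 12 20 [] ∷ []) ∷ []) ∷ node 27 24 [ node 10 18 [ node 17 25 [] ] ] ∷ node 31 22
    (node 10 20 [ node 17 25 [] ] ∷ node 10 22 [] ∷ []) ∷ []) ] ] ∷ node 17 26 (node 46 17 (node
    11 19 [ node 48 16 (node 12 20 [ node 31 18 [ node 27 20 [] ] ] ∷ node 10 18 (node 29 20 [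
    node 27 20 [] ] ∷ node 27 22 [] ∷ []) ∷ []) ] ∷ node 44 18 (node 11 19 (node 12 20 [ node 31
    16 [ node 27 18 [] ] ] ∷ node 10 18 (node 29 18 [ node 27 18 [] ] ∷ node 27 20 [] ∷ []) ∷ [])
    ∷ node 3 16 (node 20 27 [ node 18 27 [] ] ∷ node 4 17 (node 22 25 [ node 20 25 [] ] ∷ node 20
    27 [] ∷ []) ∷ node 18 29 [] ∷ []) ∷ []) ∷ []) ∷ node 54 14 (node 3 16 (node 27 28 [ node 10 18
    [ node 20 31 [] ] ] ∷ node 64 6 (node 62 7 (node 22 30 (node 4 17 (node 44 19 [ node 20 25 []
    ] ∷ node 20 31 [] ∷ []) ∷ node 18 33 [] ∷ []) ∷ node 18 33 [ node 42 21 [] ] ∷ node 20 32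
    (node 42 21 [] ∷ node 18 33 [] ∷ []) ∷ []) ∷ node 52 15 (node 18 33 [ node 20 33 [] ] ∷ node
    18 35 [] ∷ []) ∷ node 18 33 [ node 42 23 [] ] ∷ node 20 32 (node 42 23 [] ∷ node 18 33 [] ∷
    []) ∷ []) ∷ []) ∷ node 44 18 (node 11 19 (node 12 20 [ node 31 20 [ node 27 18 [] ] ] ∷ node
    10 18 (node 29 22 [ node 27 18 [] ] ∷ node 27 24 [] ∷ []) ∷ []) ∷ node 3 16 (node 20 31 [ node
    18 27 [] ] ∷ node 4 17 (node 22 29 [ node 20 25 [] ] ∷ node 20 31 [] ∷ []) ∷ node 18 33 [] ∷
    []) ∷ []) ∷ node 3 16 (node 4 17 (node 22 33 [ node 20 31 [] ] ∷ node 20 35 [] ∷ []) ∷ node 20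
    35 [ node 18 33 [] ] ∷ node 18 37 [] ∷ []) ∷ []) ∷ []) ∷ []) ∷ node 75 16 (node 68 11 (node 52
    24 (node 11 34 [ node 69 11 (node 12 35 [ node 46 24 [ node 17 36 [] ] ] ∷ node 10 33 (node 44
    26 [ node 17 36 [] ] ∷ node 42 28 [] ∷ []) ∷ []) ] ∷ node 11 34 (node 48 22 (node 12 35 [ node
    46 23 [ node 17 32 [] ] ] ∷ node 50 21 (node 12 37 [ node 17 34 [] ] ∷ node 12 39 [] ∷ []) ∷
    []) ∷ node 71 9 (node 12 41 [ node 42 30 [] ] ∷ node 44 26 (node 10 33 (node 46 26 [ node 17
    30 [] ] ∷ node 42 27 [] ∷ []) ∷ node 12 41 [] ∷ []) ∷ node 17 37 (node 42 30 [] ∷ node 12 41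
    [] ∷ []) ∷ []) ∷ []) ∷ []) ∷ node 11 34 [ node 51 21 (node 70 10 (node 12 35 [ node 46 25 [
    node 42 27 [] ] ] ∷ node 10 33 (node 44 27 [ node 42 27 [] ] ∷ node 42 29 [] ∷ []) ∷ []) ∷
    node 17 33 (node 12 35 [ node 64 13 (node 66 12 (node 46 19 [ node 48 19 [] ] ∷ node 46 21 []
    ∷ []) ∷ node 62 14 (node 46 17 [ node 48 17 [] ] ∷ node 46 17 [ node 48 17 [] ] ∷ []) ∷ node
    66 12 (node 46 21 [] ∷ node 46 19 [ node 48 19 [] ] ∷ []) ∷ []) ] ∷ node 48 22 (node 46 23 [
    node 12 35 [] ] ∷ node 12 37 [] ∷ []) ∷ []) ∷ node 70 10 (node 12 40 [ node 42 29 [] ] ∷ node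
    53 23 (node 12 40 [ node 42 27 [] ] ∷ node 12 42 [] ∷ []) ∷ node 42 27 (node 43 28 [] ∷ node
    12 40 [] ∷ []) ∷ []) ∷ []) ] ∷ node 11 35 (node 50 22 (node 62 14 (node 12 36 [ node 47 22 [
    node 42 21 [] ] ] ∷ node 47 22 (node 10 33 (node 17 31 [ node 44 19 [] ] ∷ node 42 21 [] ∷ [])
    ∷ node 17 32 (node 42 21 [] ∷ node 12 36 [] ∷ []) ∷ []) ∷ []) ∷ node 12 37 [ node 70 10 (node
    47 24 [ node 17 34 [] ] ∷ node 52 24 (node 17 34 [ node 47 22 [] ] ∷ node 17 36 [] ∷ []) ∷
    node 47 22 (node 48 23 [] ∷ node 17 34 [] ∷ []) ∷ []) ] ∷ node 54 23 (node 52 24 (node 12 39 [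
    node 17 36 [] ] ∷ node 12 41 [] ∷ []) ∷ node 12 39 [ node 17 38 [] ] ∷ node 12 43 [] ∷ []) ∷
    []) ∷ node 54 20 (node 12 36 (node 64 13 (node 66 12 (node 42 23 [ node 47 20 [] ] ∷ node 42
    25 [] ∷ []) ∷ node 62 14 (node 42 21 [ node 47 18 [] ] ∷ node 42 21 [ node 47 18 [] ] ∷ []) ∷
    node 66 12 (node 42 25 [] ∷ node 42 23 [ node 47 20 [] ] ∷ []) ∷ []) ∷ node 72 9 (node 42 31
    [] ∷ node 47 26 [ node 42 27 [] ] ∷ node 70 10 (node 42 29 [] ∷ node 42 27 [ node 47 24 [] ] ∷
    []) ∷ []) ∷ []) ∷ node 10 33 (node 70 10 (node 44 27 [ node 17 38 [] ] ∷ node 56 20 (node 17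
    38 [ node 44 25 [] ] ∷ node 17 40 [] ∷ []) ∷ node 44 25 (node 45 26 [] ∷ node 17 38 [] ∷ []) ∷
    []) ∷ node 72 9 (node 42 31 [] ∷ node 70 10 (node 42 29 [] ∷ node 42 27 [ node 44 27 [] ] ∷
    []) ∷ node 44 29 [ node 42 27 [] ] ∷ []) ∷ []) ∷ node 17 34 (node 18 35 (node 64 13 (node 66
    12 (node 47 18 [ node 52 15 [] ] ∷ node 47 20 [] ∷ []) ∷ node 47 16 (node 62 14 [ node 52 13
    [] ] ∷ node 52 13 [ node 62 14 [] ] ∷ []) ∷ node 66 12 (node 47 20 [] ∷ node 47 18 [ node 52
    15 [] ] ∷ []) ∷ []) ∷ node 72 9 (node 47 26 [] ∷ node 47 22 [ node 52 21 [] ] ∷ node 70 10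
    (node 47 24 [] ∷ node 47 22 [ node 52 19 [] ] ∷ []) ∷ []) ∷ []) ∷ node 12 36 [ node 64 13
    (node 66 12 (node 47 20 [] ∷ node 49 18 [ node 47 18 [] ] ∷ []) ∷ node 66 12 (node 47 20 [] ∷
    node 49 18 [ node 47 18 [] ] ∷ []) ∷ node 62 14 (node 49 16 [ node 47 16 [] ] ∷ node 49 16 [
    node 47 16 [] ] ∷ []) ∷ []) ] ∷ node 49 16 (node 12 36 [ node 64 13 (node 50 19 [] ∷ node 62
    14 [ node 47 16 [] ] ∷ []) ] ∷ node 64 13 (node 50 19 [] ∷ node 12 36 [ node 62 14 [ node 47
    16 [] ] ] ∷ []) ∷ node 12 38 [] ∷ []) ∷ []) ∷ node 65 12 (node 17 39 (node 42 27 [] ∷ node 12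
    43 [] ∷ []) ∷ node 42 24 (node 43 26 [] ∷ node 12 43 [] ∷ []) ∷ node 44 20 (node 10 33 (node
    62 14 [ node 42 21 [] ] ∷ node 27 21 (node 47 22 [] ∷ node 62 14 [ node 47 19 [] ] ∷ []) ∷ [])
    ∷ node 10 32 (node 17 38 [] ∷ node 62 14 [ node 17 31 [ node 47 19 [] ] ] ∷ []) ∷ node 12 43
    [] ∷ []) ∷ []) ∷ []) ∷ []) ∷ []) ∷ node 49 30 (node 11 34 [ node 51 29 (node 12 35 [ node 46
    30 [ node 17 33 [] ] ] ∷ node 10 33 (node 44 32 [ node 17 33 [] ] ∷ node 42 34 [] ∷ []) ∷ [])
    ] ∷ node 10 32 (node 45 32 (node 11 33 [ node 43 33 [ node 17 29 [] ] ] ∷ node 47 31 (node 11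
    35 [ node 17 31 [] ] ∷ node 11 37 [] ∷ []) ∷ []) ∷ node 53 28 (node 17 37 [ node 11 39 [] ] ∷
    node 51 29 (node 11 39 [ node 17 35 [] ] ∷ node 11 41 [] ∷ []) ∷ node 11 43 [] ∷ []) ∷ []) ∷
    []) ∷ node 82 11 (node 11 34 [ node 51 28 (node 77 15 (node 12 35 [ node 46 32 [ node 42 34 []
    ] ] ∷ node 10 33 (node 44 34 [ node 42 34 [] ] ∷ node 42 36 [] ∷ []) ∷ []) ∷ node 17 33 (node
    12 35 [ node 64 20 (node 66 19 (node 46 19 [ node 48 19 [] ] ∷ node 46 21 [] ∷ []) ∷ node 62
    21 (node 46 17 [ node 48 17 [] ] ∷ node 46 17 [ node 48 17 [] ] ∷ []) ∷ node 66 19 (node 46 21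
    [] ∷ node 46 19 [ node 48 19 [] ] ∷ []) ∷ []) ] ∷ node 48 29 (node 46 30 [ node 12 35 [] ] ∷
    node 12 37 [] ∷ []) ∷ []) ∷ node 77 15 (node 12 40 [ node 42 36 [] ] ∷ node 53 30 (node 12 40
    [ node 42 34 [] ] ∷ node 12 42 [] ∷ []) ∷ node 42 34 (node 43 35 [] ∷ node 12 40 [] ∷ []) ∷
    []) ∷ []) ] ∷ node 0 11 (node 1 12 [ node 44 40 (node 42 41 [ node 12 31 [ node 14 31 [] ] ] ∷
    node 46 39 (node 12 33 [ node 14 33 [] ] ∷ node 12 35 [] ∷ []) ∷ []) ] ∷ node 44 40 (node 10
    33 [ node 42 41 [ node 12 33 [] ] ] ∷ node 46 39 (node 10 35 [ node 12 35 [] ] ∷ node 10 37 []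
    ∷ []) ∷ []) ∷ []) ∷ node 19 29 (node 4 17 (node 10 19 (node 51 33 (node 49 34 [ node 22 28 [
    node 27 25 [] ] ] ∷ node 53 32 (node 22 30 [ node 27 27 [] ] ∷ node 22 32 [] ∷ []) ∷ []) ∷
    node 55 24 (node 84 10 (node 27 29 (node 22 28 [ node 77 15 (node 49 29 [] ∷ node 57 26 [ node
    49 27 [] ] ∷ []) ] ∷ node 22 28 [ node 77 15 (node 49 29 [] ∷ node 49 27 [ node 57 26 [] ] ∷
    []) ] ∷ []) ∷ node 80 12 (node 43 22 (node 66 17 (node 62 19 [ node 44 23 [] ] ∷ node 44 23 [
    node 62 19 [] ] ∷ []) ∷ node 42 21 (node 64 19 [ node 62 19 [] ] ∷ node 62 21 [] ∷ []) ∷ node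
    62 21 [ node 49 27 [ node 22 28 [] ] ] ∷ []) ∷ node 59 24 [ node 27 29 (node 28 32 [] ∷ node
    57 24 [ node 28 30 [] ] ∷ []) ] ∷ node 27 30 (node 58 25 [ node 56 25 [] ] ∷ node 60 23 [ node
    58 23 [ node 28 31 [] ] ] ∷ []) ∷ []) ∷ node 27 30 (node 58 27 [ node 28 31 [] ] ∷ node 56 29
    [] ∷ []) ∷ node 27 30 (node 58 27 [ node 22 28 [ node 49 27 [] ] ] ∷ node 58 27 [ node 56 27
    [] ] ∷ []) ∷ []) ∷ node 59 25 (node 27 33 [ node 22 34 [] ] ∷ node 57 26 (node 22 34 [ node 27
    31 [] ] ∷ node 22 36 [] ∷ []) ∷ node 22 38 [] ∷ []) ∷ node 51 26 (node 49 27 (node 27 25 [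
    node 22 28 [] ] ∷ node 27 25 [ node 22 28 [] ] ∷ []) ∷ node 53 25 (node 27 27 [ node 22 30 []
    ] ∷ node 22 32 [] ∷ []) ∷ node 53 25 (node 27 27 [ node 22 30 [] ] ∷ node 22 32 [] ∷ []) ∷ [])
    ∷ node 59 25 (node 27 33 [ node 22 34 [] ] ∷ node 57 26 [ node 22 34 [ node 27 31 [] ] ] ∷ [])
    ∷ []) ∷ []) ∷ node 22 31 (node 56 28 (node 49 27 [ node 23 32 [ node 54 29 [] ] ] ∷ node 58 27
    (node 23 34 [ node 49 27 [] ] ∷ node 23 36 [] ∷ []) ∷ []) ∷ node 51 33 (node 20 30 [ node 49
    34 [] ] ∷ node 20 32 [] ∷ []) ∷ []) ∷ node 54 30 (node 23 30 (node 51 32 (node 20 30 [ node 49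
    27 [] ] ∷ node 20 32 [] ∷ []) ∷ node 22 28 (node 51 32 [ node 49 27 [] ] ∷ node 49 34 [] ∷ [])
    ∷ node 51 32 [ node 20 30 [ node 49 27 [] ] ] ∷ []) ∷ node 20 31 (node 56 29 (node 22 33 [
    node 49 27 [] ] ∷ node 22 35 [] ∷ []) ∷ node 49 27 (node 50 33 [] ∷ node 22 33 [] ∷ []) ∷ [])
    ∷ node 3 15 (node 17 11 (node 56 29 (node 27 30 [ node 22 33 [] ] ∷ node 22 35 [] ∷ []) ∷ node
    27 26 (node 22 28 (node 51 32 [ node 49 27 [] ] ∷ node 49 34 [] ∷ []) ∷ node 51 32 (node 22 28
    [ node 49 27 [] ] ∷ node 22 30 [] ∷ []) ∷ node 51 32 [ node 22 28 [ node 49 27 [] ] ] ∷ []) ∷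
    []) ∷ node 56 29 (node 49 27 (node 20 35 [] ∷ node 22 28 (node 23 32 [] ∷ node 17 25 [] ∷ [])
    ∷ []) ∷ node 20 35 [ node 22 35 [] ] ∷ []) ∷ node 56 29 (node 43 19 (node 17 27 [] ∷ node 17
    25 [ node 22 33 [] ] ∷ []) ∷ node 17 25 [ node 22 35 [] ] ∷ []) ∷ []) ∷ []) ∷ []) ∷ node 49 35
    (node 10 33 [ node 50 35 (node 11 34 [ node 44 32 [] ] ∷ node 42 34 [] ∷ []) ] ∷ node 10 33
    (node 46 37 (node 11 34 [ node 44 32 [] ] ∷ node 11 36 [] ∷ []) ∷ node 87 8 (node 77 15 (node
    42 36 [] ∷ node 42 34 [ node 44 34 [] ] ∷ []) ∷ node 44 33 (node 42 34 [] ∷ node 50 38 [] ∷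
    []) ∷ node 85 9 (node 62 24 (node 42 34 [] ∷ node 44 19 (node 45 31 [] ∷ node 20 30 [] ∷ []) ∷
    []) ∷ node 44 33 (node 42 34 [] ∷ node 50 36 [] ∷ []) ∷ node 42 34 [ node 50 36 [] ] ∷ []) ∷
    node 50 38 [ node 42 34 [] ] ∷ []) ∷ []) ∷ []) ∷ node 10 33 (node 46 38 (node 11 34 [ node 44
    39 [] ] ∷ node 11 36 [] ∷ []) ∷ node 87 8 (node 85 9 (node 42 44 [] ∷ node 46 38 (node 42 41
    [] ∷ node 11 34 [ node 49 37 [ node 44 32 [] ] ] ∷ []) ∷ node 44 42 [ node 42 41 [] ] ∷ []) ∷
    node 42 46 [] ∷ node 49 39 (node 42 41 [] ∷ node 11 34 [ node 46 37 [ node 44 32 [] ] ] ∷ [])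
    ∷ node 44 44 [ node 42 41 [] ] ∷ []) ∷ []) ∷ []) ∷ []) ∷ node 83 12 (node 11 35 (node 50 29
    (node 62 22 (node 12 36 [ node 47 29 [ node 42 21 [] ] ] ∷ node 47 29 (node 10 33 (node 17 31
    [ node 44 19 [] ] ∷ node 42 21 [] ∷ []) ∷ node 17 32 (node 42 21 [] ∷ node 12 36 [] ∷ []) ∷
    []) ∷ []) ∷ node 12 37 [ node 77 15 (node 47 31 [ node 17 34 [] ] ∷ node 52 32 (node 17 34 [
    node 47 29 [] ] ∷ node 17 36 [] ∷ []) ∷ node 47 29 (node 48 30 [] ∷ node 17 34 [] ∷ []) ∷ [])
    ] ∷ node 54 31 (node 52 32 (node 12 39 [ node 17 36 [] ] ∷ node 12 41 [] ∷ []) ∷ node 12 39 [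
    node 17 38 [] ] ∷ node 12 43 [] ∷ []) ∷ []) ∷ node 54 27 (node 12 36 (node 64 21 (node 66 20
    (node 42 23 [ node 47 20 [] ] ∷ node 42 25 [] ∷ []) ∷ node 62 22 (node 42 21 [ node 47 18 [] ]
    ∷ node 42 21 [ node 47 18 [] ] ∷ []) ∷ node 66 20 (node 42 25 [] ∷ node 42 23 [ node 47 20 []
    ] ∷ []) ∷ []) ∷ node 79 14 (node 42 38 [] ∷ node 47 33 [ node 42 34 [] ] ∷ node 77 15 (node 42
    36 [] ∷ node 42 34 [ node 47 31 [] ] ∷ []) ∷ []) ∷ []) ∷ node 10 33 (node 77 15 (node 44 34 [
    node 17 38 [] ] ∷ node 56 28 (node 17 38 [ node 44 32 [] ] ∷ node 17 40 [] ∷ []) ∷ node 44 32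
    (node 45 33 [] ∷ node 17 38 [] ∷ []) ∷ []) ∷ node 79 14 (node 42 38 [] ∷ node 77 15 (node 42
    36 [] ∷ node 42 34 [ node 44 34 [] ] ∷ []) ∷ node 44 36 [ node 42 34 [] ] ∷ []) ∷ []) ∷ node
    17 34 (node 18 35 (node 64 21 (node 66 20 (node 47 18 [ node 52 15 [] ] ∷ node 47 20 [] ∷ [])
    ∷ node 47 16 (node 62 22 [ node 52 13 [] ] ∷ node 52 13 [ node 62 22 [] ] ∷ []) ∷ node 66 20
    (node 47 20 [] ∷ node 47 18 [ node 52 15 [] ] ∷ []) ∷ []) ∷ node 79 14 (node 47 33 [] ∷ node
    47 29 [ node 52 28 [] ] ∷ node 77 15 (node 47 31 [] ∷ node 47 29 [ node 52 26 [] ] ∷ []) ∷ [])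
    ∷ []) ∷ node 12 36 [ node 64 21 (node 66 20 (node 47 20 [] ∷ node 49 18 [ node 47 18 [] ] ∷
    []) ∷ node 66 20 (node 47 20 [] ∷ node 49 18 [ node 47 18 [] ] ∷ []) ∷ node 62 22 (node 49 16
    [ node 47 16 [] ] ∷ node 49 16 [ node 47 16 [] ] ∷ []) ∷ []) ] ∷ node 49 16 (node 12 36 [ node
    64 21 (node 50 26 [] ∷ node 62 22 [ node 47 16 [] ] ∷ []) ] ∷ node 64 21 (node 50 26 [] ∷ node
    12 36 [ node 62 22 [ node 47 16 [] ] ] ∷ []) ∷ node 12 38 [] ∷ []) ∷ []) ∷ node 65 20 (node 17
    39 (node 42 34 [] ∷ node 12 43 [] ∷ []) ∷ node 42 24 (node 43 33 [] ∷ node 12 43 [] ∷ []) ∷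
    node 44 20 (node 10 33 (node 62 22 [ node 42 21 [] ] ∷ node 27 21 (node 47 29 [] ∷ node 62 22
    [ node 47 19 [] ] ∷ []) ∷ []) ∷ node 10 32 (node 17 38 [] ∷ node 62 22 [ node 17 31 [ node 47
    19 [] ] ] ∷ []) ∷ node 12 43 [] ∷ []) ∷ []) ∷ []) ∷ []) ∷ node 54 26 (node 78 14 (node 62 22
    (node 11 34 (node 12 35 [ node 46 30 [ node 42 21 [] ] ] ∷ node 10 33 (node 44 32 [ node 42 21
    [] ] ∷ node 42 34 [] ∷ []) ∷ []) ∷ node 19 28 (node 10 33 (node 42 21 [ node 44 32 [] ] ∷ node
    11 34 (node 46 30 [ node 44 19 [] ] ∷ node 44 32 [] ∷ []) ∷ node 42 34 [] ∷ []) ∷ node 0 11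
    (node 43 20 (node 48 28 [ node 3 18 (node 20 29 [] ∷ node 12 30 [ node 22 27 [] ] ∷ []) ] ∷
    node 48 28 [ node 3 18 (node 20 29 [] ∷ node 22 27 [ node 12 30 [] ] ∷ []) ] ∷ []) ∷ node 3 15
    (node 29 27 (node 12 16 (node 17 13 [ node 27 28 [] ] ∷ node 27 28 [ node 17 13 [] ] ∷ []) ∷
    node 31 26 (node 12 18 [ node 17 15 [] ] ∷ node 12 20 [] ∷ []) ∷ node 12 18 [ node 20 29 [
    node 48 28 [] ] ] ∷ []) ∷ node 12 31 [ node 46 18 (node 42 21 [] ∷ node 17 28 [ node 44 19 []
    ] ∷ []) ] ∷ node 45 19 (node 12 30 [ node 17 29 [] ] ∷ node 12 30 [ node 17 27 [ node 43 20 []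
    ] ] ∷ []) ∷ []) ∷ node 44 20 (node 10 33 [ node 42 21 [] ] ∷ node 10 35 [] ∷ []) ∷ node 43 20
    (node 10 32 [ node 48 28 [ node 20 29 [] ] ] ∷ node 10 32 [ node 12 32 [] ] ∷ []) ∷ []) ∷ node
    21 30 (node 20 29 (node 48 15 [ node 50 26 [] ] ∷ node 48 28 [] ∷ []) ∷ node 22 31 (node 48 15
    [ node 52 24 [] ] ∷ node 48 15 [ node 52 24 [] ] ∷ []) ∷ node 20 29 (node 48 28 [] ∷ node 48
    15 [ node 50 26 [] ] ∷ []) ∷ []) ∷ node 10 33 (node 42 21 [ node 44 32 [] ] ∷ node 11 34 [
    node 46 30 [ node 44 19 [] ] ] ∷ []) ∷ []) ∷ []) ∷ node 48 29 (node 11 34 (node 17 32 [ node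
    46 30 [ node 12 35 [] ] ] ∷ node 10 33 (node 44 32 [ node 17 32 [] ] ∷ node 42 34 [] ∷ []) ∷
    []) ∷ node 10 40 (node 51 28 [ node 11 41 [] ] ∷ node 49 30 [] ∷ []) ∷ []) ∷ node 11 34 (node
    46 30 (node 12 36 (node 49 30 [ node 17 33 [] ] ∷ node 47 32 [] ∷ []) ∷ node 48 29 (node 12 35
    [ node 17 32 [] ] ∷ node 12 37 [] ∷ []) ∷ node 12 35 [ node 48 31 [ node 17 32 [] ] ] ∷ []) ∷
    node 46 33 (node 10 33 (node 44 32 [ node 17 30 [] ] ∷ node 42 34 [] ∷ []) ∷ node 17 31 (node
    42 34 [] ∷ node 12 35 [] ∷ []) ∷ []) ∷ node 81 12 (node 62 20 (node 10 33 (node 42 21 [ node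
    44 32 [] ] ∷ node 42 34 [] ∷ []) ∷ node 46 17 (node 12 36 (node 49 27 [ node 17 33 [] ] ∷ node
    47 29 [] ∷ []) ∷ node 48 28 (node 12 35 [ node 17 32 [] ] ∷ node 12 37 [] ∷ []) ∷ node 12 35 [
    node 48 28 [ node 17 32 [] ] ] ∷ []) ∷ []) ∷ node 10 33 (node 17 30 (node 44 35 [] ∷ node 46
    31 (node 44 32 [] ∷ node 55 27 [] ∷ []) ∷ []) ∷ node 44 35 [ node 42 34 [] ] ∷ []) ∷ node 10
    33 (node 27 29 (node 55 27 [] ∷ node 57 25 [ node 44 32 [] ] ∷ []) ∷ node 55 27 [ node 42 34
    [] ] ∷ []) ∷ []) ∷ []) ∷ []) ∷ node 14 29 (node 57 28 [ node 10 32 (node 55 29 [ node 17 39 []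
    ] ∷ node 17 41 [] ∷ []) ] ∷ node 59 26 (node 15 41 (node 57 27 [ node 17 41 [] ] ∷ node 55 29
    [] ∷ []) ∷ node 0 11 (node 3 15 (node 17 43 [] ∷ node 19 41 [ node 17 38 [] ] ∷ []) ∷ node 17
    38 (node 18 42 [] ∷ node 10 32 [] ∷ []) ∷ node 1 12 (node 12 16 (node 17 43 [] ∷ node 27 29
    (node 42 34 [] ∷ node 17 38 [] ∷ []) ∷ []) ∷ node 17 38 (node 18 42 [] ∷ node 12 30 [] ∷ []) ∷
    node 17 43 [ node 12 30 [] ] ∷ []) ∷ node 10 32 [ node 17 43 [] ] ∷ []) ∷ []) ∷ []) ∷ node 59
    26 (node 10 46 (node 57 27 [ node 11 47 [] ] ∷ node 55 29 [] ∷ []) ∷ node 0 11 (node 1 12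
    (node 12 48 [] ∷ node 14 41 (node 15 45 [] ∷ node 56 28 [ node 12 30 [ node 17 40 [] ] ] ∷ [])
    ∷ node 12 43 [ node 14 46 [] ] ∷ []) ∷ node 10 50 [] ∷ node 10 32 (node 12 48 [] ∷ node 56 28
    [ node 12 43 [ node 17 40 [] ] ] ∷ []) ∷ node 10 45 [ node 12 48 [] ] ∷ []) ∷ []) ∷ []) ∷ node
    4 17 (node 53 32 (node 22 25 (node 48 36 [ node 5 19 (node 23 26 [ node 42 34 [] ] ∷ node 17
    26 (node 44 32 [ node 25 24 [] ] ∷ node 42 34 [] ∷ []) ∷ node 25 25 (node 23 26 [] ∷ node 42
    34 [] ∷ []) ∷ []) ] ∷ node 23 27 (node 51 33 [ node 24 28 [ node 48 28 [] ] ] ∷ node 10 18 [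
    node 48 28 (node 27 27 [] ∷ node 49 35 [] ∷ []) ] ∷ []) ∷ node 17 26 (node 42 34 [ node 44 40
    [] ] ∷ node 18 27 (node 46 38 [ node 44 32 [] ] ∷ node 44 40 [] ∷ []) ∷ node 42 42 [] ∷ []) ∷
    []) ∷ node 22 23 (node 56 30 (node 5 19 (node 23 31 [ node 42 34 [] ] ∷ node 17 26 (node 44 32
    [ node 25 29 [] ] ∷ node 42 34 [] ∷ []) ∷ node 25 30 (node 23 31 [] ∷ node 42 34 [] ∷ []) ∷
    []) ∷ node 5 19 (node 23 34 [] ∷ node 17 11 (node 25 32 [] ∷ node 27 28 (node 42 34 [] ∷ node
    25 29 [] ∷ []) ∷ []) ∷ node 23 31 [ node 25 32 [] ] ∷ []) ∷ []) ∷ node 5 19 (node 23 25 (node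
    55 31 (node 46 30 [ node 25 29 [] ] ∷ node 25 31 [] ∷ []) ∷ node 46 30 (node 47 37 [] ∷ node
    25 29 [] ∷ []) ∷ []) ∷ node 48 29 (node 17 11 (node 25 21 (node 49 35 [ node 27 23 [] ] ∷ node
    27 27 [] ∷ []) ∷ node 25 22 (node 49 35 [ node 27 23 [] ] ∷ node 46 30 [ node 27 22 [] ] ∷ [])
    ∷ []) ∷ node 23 31 [] ∷ node 50 34 [ node 17 11 (node 25 24 [ node 27 24 [] ] ∷ node 25 24 [
    node 27 24 [] ] ∷ []) ] ∷ []) ∷ []) ∷ node 48 36 (node 27 22 (node 46 30 [ node 5 19 (node 23
    24 [] ∷ node 17 11 [ node 25 22 [] ] ∷ []) ] ∷ node 29 25 (node 17 13 [ node 10 18 [] ] ∷ node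
    10 20 [] ∷ []) ∷ node 46 30 [ node 10 18 [ node 23 24 [] ] ] ∷ []) ∷ node 46 30 (node 27 20
    (node 10 19 (node 28 21 [] ∷ node 17 14 [ node 30 19 [] ] ∷ []) ∷ node 10 18 [ node 17 13 [
    node 29 20 [] ] ] ∷ node 29 20 (node 10 18 [ node 17 13 [] ] ∷ node 10 20 [] ∷ []) ∷ []) ∷
    node 5 19 (node 23 26 [] ∷ node 25 24 [ node 23 24 [] ] ∷ []) ∷ []) ∷ []) ∷ node 27 28 (node
    42 42 [] ∷ node 5 19 (node 23 31 [] ∷ node 25 29 [ node 17 11 [] ] ∷ []) ∷ node 17 12 (node 23
    31 [] ∷ node 10 18 [] ∷ []) ∷ []) ∷ []) ∷ []) ∷ node 17 29 (node 49 36 (node 42 34 [ node 18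
    30 [ node 47 37 [] ] ] ∷ node 51 35 (node 18 32 [ node 42 34 [] ] ∷ node 18 34 [] ∷ []) ∷ [])
    ∷ node 44 41 (node 42 42 [ node 10 33 [] ] ∷ node 10 35 [] ∷ []) ∷ []) ∷ node 19 27 (node 50
    35 (node 47 37 (node 10 33 (node 22 26 [ node 44 32 [] ] ∷ node 42 34 [] ∷ []) ∷ node 22 27
    (node 20 28 [] ∷ node 42 34 [] ∷ []) ∷ []) ∷ node 53 33 (node 10 33 (node 22 29 [ node 44 32
    [] ] ∷ node 42 34 [] ∷ []) ∷ node 3 15 (node 17 11 (node 22 32 [] ∷ node 27 25 (node 42 34 []
    ∷ node 22 29 [] ∷ []) ∷ []) ∷ node 22 29 (node 23 31 [] ∷ node 17 25 [] ∷ []) ∷ node 17 25 [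
    node 22 32 [] ] ∷ []) ∷ []) ∷ node 53 33 (node 22 30 (node 20 31 [] ∷ node 42 34 [] ∷ []) ∷
    node 20 31 [ node 22 32 [] ] ∷ []) ∷ []) ∷ node 51 34 (node 49 35 (node 43 33 (node 22 28 [
    node 10 32 [] ] ∷ node 10 34 [] ∷ []) ∷ node 47 29 (node 20 30 [] ∷ node 22 26 (node 23 27 []
    ∷ node 10 32 [] ∷ []) ∷ []) ∷ []) ∷ node 22 30 (node 53 33 (node 47 29 [ node 20 28 [] ] ∷
    node 23 31 [] ∷ []) ∷ node 10 32 [] ∷ []) ∷ node 53 33 (node 47 29 (node 20 32 [] ∷ node 22 26
    (node 23 29 [] ∷ node 10 32 [] ∷ []) ∷ []) ∷ node 20 32 [ node 22 32 [] ] ∷ []) ∷ []) ∷ node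
    44 20 (node 10 32 [ node 88 9 (node 49 36 (node 45 39 [] ∷ node 22 26 (node 47 29 [ node 62 27
    [] ] ∷ node 47 37 [] ∷ []) ∷ []) ∷ node 86 10 (node 49 36 (node 45 39 [] ∷ node 22 26 (node 62
    25 [ node 47 29 [] ] ∷ node 47 37 [] ∷ []) ∷ []) ∷ node 45 42 [] ∷ node 45 39 [ node 47 40 []
    ] ∷ []) ∷ node 45 44 [] ∷ node 45 39 [ node 47 42 [] ] ∷ []) ] ∷ node 79 14 (node 10 33 [ node
    77 15 (node 49 31 (node 45 33 [] ∷ node 22 26 [ node 47 31 [] ] ∷ []) ∷ node 22 26 [ node 47
    29 (node 62 18 [ node 49 29 [] ] ∷ node 49 29 [ node 62 18 [] ] ∷ []) ] ∷ node 42 21 (node 47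
    31 [ node 62 18 [] ] ∷ node 47 31 [ node 62 18 [] ] ∷ []) ∷ []) ] ∷ node 10 32 [ node 49 35
    (node 45 35 [] ∷ node 47 33 [ node 22 26 [] ] ∷ []) ] ∷ node 10 32 [ node 81 13 (node 22 26 [
    node 47 29 (node 62 20 [ node 49 31 [] ] ∷ node 49 31 [ node 62 20 [] ] ∷ []) ] ∷ node 45 37
    [] ∷ node 45 35 [ node 47 35 [] ] ∷ []) ] ∷ node 49 32 (node 10 32 [ node 22 26 [ node 47 33
    [] ] ] ∷ node 10 32 [ node 22 28 [] ] ∷ []) ∷ []) ∷ node 10 35 [] ∷ node 87 10 (node 49 36
    (node 45 39 [] ∷ node 62 26 [ node 47 29 [ node 22 26 [ node 10 32 [] ] ] ] ∷ []) ∷ node 45 43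
    [] ∷ node 85 11 (node 10 32 [ node 22 26 [ node 47 29 (node 62 24 [ node 49 35 [] ] ∷ node 49
    35 [ node 62 24 [] ] ∷ []) ] ] ∷ node 45 41 [] ∷ node 47 39 [ node 45 39 [] ] ∷ []) ∷ node 47
    41 [ node 45 39 [] ] ∷ []) ∷ []) ∷ []) ∷ []) ∷ node 0 11 (node 12 33 (node 51 34 (node 48 36
    (node 10 18 (node 27 25 [ node 17 32 [] ] ∷ node 27 25 [ node 17 32 [] ] ∷ []) ∷ node 19 31
    (node 3 15 (node 17 32 [] ∷ node 46 30 [ node 17 30 [] ] ∷ []) ∷ node 13 36 [] ∷ []) ∷ []) ∷
    node 13 35 (node 53 33 (node 46 30 [ node 17 35 [] ] ∷ node 17 37 [] ∷ []) ∷ node 46 30 (node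
    47 37 [] ∷ node 17 35 [] ∷ []) ∷ []) ∷ node 54 32 (node 19 34 (node 3 15 (node 17 35 [] ∷ node
    46 30 [ node 17 30 [] ] ∷ []) ∷ node 13 39 [] ∷ []) ∷ node 13 39 [ node 17 38 [] ] ∷ []) ∷ [])
    ∷ node 49 36 (node 46 38 (node 10 33 (node 44 32 [ node 17 30 [] ] ∷ node 42 34 [] ∷ []) ∷
    node 17 31 (node 42 34 [] ∷ node 13 34 [] ∷ []) ∷ []) ∷ node 51 35 (node 10 33 (node 44 32 [
    node 17 33 [] ] ∷ node 42 34 [] ∷ []) ∷ node 3 15 (node 17 35 [] ∷ node 19 33 [ node 17 33 []
    ] ∷ []) ∷ []) ∷ node 52 34 (node 17 34 (node 42 34 [] ∷ node 13 37 [] ∷ []) ∷ node 13 37 [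
    node 17 36 [] ] ∷ []) ∷ []) ∷ node 19 32 (node 89 8 (node 87 9 (node 42 46 [] ∷ node 3 15
    (node 48 37 (node 42 42 [] ∷ node 52 36 [ node 17 30 [ node 46 30 [] ] ] ∷ []) ∷ node 48 18
    (node 52 36 [ node 49 35 [] ] ∷ node 17 32 [] ∷ node 54 18 (node 17 30 [ node 64 13 (node 46
    17 [ node 67 17 (node 62 14 [] ∷ node 68 20 [] ∷ []) ] ∷ node 67 21 (node 46 17 [ node 62 14
    [] ] ∷ node 55 21 [] ∷ []) ∷ node 46 19 [] ∷ []) ] ∷ node 20 33 [ node 69 16 (node 67 17 (node
    52 16 [ node 62 14 [] ] ∷ node 52 16 [ node 62 14 [] ] ∷ []) ∷ node 71 15 (node 52 18 [ node
    62 14 [] ] ∷ node 55 21 [] ∷ []) ∷ node 71 15 (node 52 18 [ node 62 14 [] ] ∷ node 55 21 [] ∷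
    []) ∷ []) ] ∷ node 20 35 [] ∷ node 17 30 [ node 64 13 (node 46 17 [ node 67 17 (node 68 20 []
    ∷ node 62 14 [] ∷ []) ] ∷ node 46 19 [] ∷ node 67 21 (node 46 17 [ node 62 14 [] ] ∷ node 55
    21 [] ∷ []) ∷ []) ] ∷ []) ∷ node 17 32 [ node 52 36 [ node 50 34 [] ] ] ∷ []) ∷ []) ∷ node 42
    42 [ node 46 42 [] ] ∷ []) ∷ node 42 48 [] ∷ node 3 15 (node 52 38 (node 42 42 [] ∷ node 48 36
    [ node 46 30 [ node 17 30 [] ] ] ∷ []) ∷ node 46 17 (node 52 38 [ node 47 37 [] ] ∷ node 17 30
    [] ∷ node 54 15 (node 20 33 [ node 62 15 (node 52 13 (node 66 24 [ node 64 20 [] ] ∷ node 64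
    26 [] ∷ []) ∷ node 66 19 (node 52 13 [ node 64 20 [] ] ∷ node 55 21 [] ∷ []) ∷ node 52 13 [
    node 64 20 [ node 66 24 [] ] ] ∷ []) ] ∷ node 20 33 [ node 66 19 (node 64 20 (node 52 13 [
    node 62 14 [] ] ∷ node 52 13 [ node 62 14 [] ] ∷ []) ∷ node 68 18 (node 52 15 [ node 62 14 []
    ] ∷ node 55 21 [] ∷ []) ∷ node 68 18 (node 52 15 [ node 62 14 [] ] ∷ node 55 21 [] ∷ []) ∷ [])
    ] ∷ node 20 35 [] ∷ node 20 33 [ node 62 15 (node 52 13 (node 64 26 [] ∷ node 64 20 [ node 66
    24 [] ] ∷ []) ∷ node 52 13 [ node 64 20 [ node 66 24 [] ] ] ∷ node 66 19 (node 52 13 [ node 64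
    20 [] ] ∷ node 55 21 [] ∷ []) ∷ []) ] ∷ []) ∷ node 17 30 [ node 48 36 [ node 52 38 [] ] ] ∷
    []) ∷ []) ∷ node 46 44 [ node 42 42 [] ] ∷ []) ∷ node 54 31 (node 56 30 (node 10 18 [ node 27
    30 [] ] ∷ node 46 16 (node 10 18 [ node 27 28 [] ] ∷ node 13 34 [] ∷ []) ∷ []) ∷ node 56 30
    (node 10 18 [ node 27 30 [] ] ∷ node 46 30 (node 10 18 [ node 27 28 [] ] ∷ node 13 34 [] ∷ [])
    ∷ []) ∷ node 46 30 (node 10 18 [ node 52 32 [ node 27 26 [] ] ] ∷ node 10 18 [ node 52 32 [
    node 27 26 [] ] ] ∷ node 13 34 [] ∷ []) ∷ []) ∷ node 54 31 (node 56 30 (node 42 34 [] ∷ node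
    10 18 [ node 46 30 [ node 27 28 [] ] ] ∷ []) ∷ node 56 30 (node 42 34 [] ∷ node 27 28 (node 46
    30 [] ∷ node 10 18 [] ∷ []) ∷ []) ∷ node 27 26 (node 52 32 [ node 46 30 [] ] ∷ node 52 32 [
    node 46 30 [] ] ∷ node 10 18 [] ∷ []) ∷ []) ∷ []) ∷ []) ∷ node 14 32 (node 52 33 (node 18 33
    (node 17 31 (node 49 35 [ node 47 29 [] ] ∷ node 47 37 [] ∷ []) ∷ node 49 35 (node 15 33 [
    node 47 29 [] ] ∷ node 15 35 [] ∷ []) ∷ node 49 35 [ node 15 33 [ node 47 29 [] ] ] ∷ []) ∷
    node 15 34 (node 54 32 (node 17 36 [ node 47 29 [] ] ∷ node 17 38 [] ∷ []) ∷ node 47 29 (node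
    48 36 [] ∷ node 17 36 [] ∷ []) ∷ []) ∷ node 1 12 (node 12 16 (node 54 32 (node 27 28 [ node 17
    36 [] ] ∷ node 17 38 [] ∷ []) ∷ node 27 24 (node 17 31 (node 47 37 [] ∷ node 49 35 [ node 47
    29 [] ] ∷ []) ∷ node 49 35 [ node 17 31 [ node 47 29 [] ] ] ∷ node 49 35 (node 17 31 [ node 47
    29 [] ] ∷ node 17 33 [] ∷ []) ∷ []) ∷ []) ∷ node 54 32 (node 47 29 (node 17 31 (node 18 35 []
    ∷ node 12 30 [] ∷ []) ∷ node 15 38 [] ∷ []) ∷ node 15 38 [ node 17 38 [] ] ∷ []) ∷ node 54 32
    (node 43 19 (node 12 30 [ node 17 36 [] ] ∷ node 12 32 [] ∷ []) ∷ node 12 30 [ node 17 38 [] ]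
    ∷ []) ∷ []) ∷ []) ∷ node 47 38 (node 44 40 (node 10 33 [ node 42 34 [] ] ∷ node 10 35 [] ∷ [])
    ∷ node 44 40 (node 10 33 [ node 42 34 [] ] ∷ node 10 35 [] ∷ []) ∷ node 50 36 (node 17 32
    (node 42 34 [] ∷ node 15 33 [] ∷ []) ∷ node 15 33 [ node 17 34 [] ] ∷ []) ∷ []) ∷ node 81 12
    (node 78 14 (node 44 36 (node 10 33 [ node 42 37 [] ] ∷ node 10 35 [] ∷ []) ∷ node 44 38 (node
    10 33 [ node 42 37 [] ] ∷ node 10 35 [] ∷ []) ∷ node 47 32 (node 44 33 (node 10 33 [ node 42
    34 [] ] ∷ node 10 35 [] ∷ []) ∷ node 44 33 (node 10 33 [ node 42 34 [] ] ∷ node 10 35 [] ∷ [])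
    ∷ node 50 32 (node 17 32 (node 42 34 [] ∷ node 15 33 [] ∷ []) ∷ node 15 33 [ node 17 34 [] ] ∷
    []) ∷ []) ∷ []) ∷ node 44 40 [ node 10 33 [ node 42 40 [] ] ] ∷ node 44 40 [ node 10 33 [ node
    42 40 [] ] ] ∷ node 44 38 (node 47 37 [ node 10 33 [ node 42 34 [] ] ] ∷ node 10 33 [ node 47
    37 [ node 42 34 [] ] ] ∷ node 10 35 [] ∷ []) ∷ []) ∷ []) ∷ node 14 32 (node 51 34 (node 49 35
    (node 43 33 (node 17 33 [ node 10 32 [] ] ∷ node 10 34 [] ∷ []) ∷ node 47 29 (node 17 31 (node
    18 32 [] ∷ node 10 32 [] ∷ []) ∷ node 15 35 [] ∷ []) ∷ []) ∷ node 17 35 (node 53 33 (node 47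
    29 [ node 15 33 [] ] ∷ node 18 36 [] ∷ []) ∷ node 10 32 [] ∷ []) ∷ node 53 33 (node 47 29
    (node 17 31 (node 18 34 [] ∷ node 10 32 [] ∷ []) ∷ node 15 37 [] ∷ []) ∷ node 15 37 [ node 17
    37 [] ] ∷ []) ∷ []) ∷ node 50 35 (node 47 37 (node 10 33 (node 17 31 [ node 44 32 [] ] ∷ node
    42 34 [] ∷ []) ∷ node 17 32 (node 42 34 [] ∷ node 15 33 [] ∷ []) ∷ []) ∷ node 53 33 (node 10
    33 (node 17 34 [ node 44 32 [] ] ∷ node 42 34 [] ∷ []) ∷ node 1 12 (node 12 16 (node 17 37 []
    ∷ node 27 25 (node 42 34 [] ∷ node 17 34 [] ∷ []) ∷ []) ∷ node 17 34 (node 18 36 [] ∷ node 12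
    30 [] ∷ []) ∷ node 12 30 [ node 17 37 [] ] ∷ []) ∷ []) ∷ node 53 33 (node 17 35 (node 42 34 []
    ∷ node 15 36 [] ∷ []) ∷ node 15 36 [ node 17 37 [] ] ∷ []) ∷ []) ∷ node 44 20 (node 10 32 [
    node 88 9 (node 49 36 (node 45 39 [] ∷ node 17 31 (node 47 37 [] ∷ node 47 29 [ node 62 27 []
    ] ∷ []) ∷ []) ∷ node 86 10 (node 49 36 (node 45 39 [] ∷ node 17 31 (node 47 37 [] ∷ node 62 25
    [ node 47 29 [] ] ∷ []) ∷ []) ∷ node 45 42 [] ∷ node 45 39 [ node 47 40 [] ] ∷ []) ∷ node 45
    44 [] ∷ node 45 39 [ node 47 42 [] ] ∷ []) ] ∷ node 87 10 (node 49 36 (node 45 39 [] ∷ node 62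
    26 [ node 47 29 [ node 17 31 [ node 10 32 [] ] ] ] ∷ []) ∷ node 45 43 [] ∷ node 85 11 (node 10
    32 [ node 17 31 [ node 47 29 (node 62 24 [ node 49 35 [] ] ∷ node 49 35 [ node 62 24 [] ] ∷
    []) ] ] ∷ node 45 41 [] ∷ node 47 39 [ node 45 39 [] ] ∷ []) ∷ node 47 41 [ node 45 39 [] ] ∷
    []) ∷ node 10 35 [] ∷ node 79 14 (node 10 33 [ node 77 15 (node 49 31 (node 45 33 [] ∷ node 17
    31 [ node 47 31 [] ] ∷ []) ∷ node 17 31 [ node 47 29 (node 62 18 [ node 49 29 [] ] ∷ node 49
    29 [ node 62 18 [] ] ∷ []) ] ∷ node 42 21 (node 47 31 [ node 62 18 [] ] ∷ node 47 31 [ node 62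
    18 [] ] ∷ []) ∷ []) ] ∷ node 10 32 [ node 49 35 (node 45 35 [] ∷ node 47 33 [ node 17 31 [] ]
    ∷ []) ] ∷ node 10 32 [ node 81 13 (node 17 31 [ node 47 29 (node 62 20 [ node 49 31 [] ] ∷
    node 49 31 [ node 62 20 [] ] ∷ []) ] ∷ node 45 37 [] ∷ node 45 35 [ node 47 35 [] ] ∷ []) ] ∷
    node 49 32 (node 10 32 [ node 17 31 [ node 47 33 [] ] ] ∷ node 10 32 [ node 17 33 [] ] ∷ []) ∷
    []) ∷ []) ∷ []) ∷ node 51 34 (node 17 30 (node 10 33 (node 12 33 (node 46 38 [ node 44 32 [] ]
    ∷ node 44 40 [] ∷ []) ∷ node 44 40 [ node 42 34 [] ] ∷ []) ∷ node 45 39 (node 43 19 (node 10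
    34 [] ∷ node 10 32 [ node 12 32 [] ] ∷ []) ∷ node 10 32 [ node 12 34 [] ] ∷ []) ∷ node 10 32 [
    node 45 39 (node 43 33 [ node 12 32 [] ] ∷ node 12 34 [] ∷ []) ] ∷ node 46 38 [ node 10 33
    (node 12 33 [ node 44 32 [] ] ∷ node 42 34 [] ∷ []) ] ∷ []) ∷ node 12 34 (node 53 33 (node 43
    33 (node 10 34 [] ∷ node 10 32 [ node 17 35 [] ] ∷ []) ∷ node 10 32 [ node 17 37 [] ] ∷ []) ∷
    node 10 32 [ node 53 33 (node 43 33 [ node 17 35 [] ] ∷ node 17 37 [] ∷ []) ] ∷ node 10 33
    (node 44 32 (node 45 39 [] ∷ node 17 35 [] ∷ []) ∷ node 44 40 [ node 42 34 [] ] ∷ []) ∷ []) ∷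
    node 46 31 (node 10 19 (node 17 16 (node 27 9 (node 34 14 (node 47 37 [] ∷ node 28 10 (node 30
    12 [ node 37 13 [ node 49 35 [] ] ] ∷ node 30 12 [ node 37 13 [ node 49 35 [] ] ] ∷ []) ∷ node
    28 10 (node 30 12 [ node 37 13 [ node 49 35 [] ] ] ∷ node 30 12 [ node 37 13 [ node 49 35 [] ]
    ] ∷ []) ∷ node 28 10 (node 30 12 [ node 37 13 [ node 49 35 [] ] ] ∷ node 30 12 [ node 37 13 [
    node 49 35 [] ] ] ∷ []) ∷ []) ∷ node 30 17 (node 31 21 [] ∷ node 48 36 [ node 34 15 [ node 18
    17 [] ] ] ∷ []) ∷ node 30 17 (node 31 21 [] ∷ node 48 36 [ node 34 15 [ node 18 17 [] ] ] ∷
    []) ∷ node 30 17 (node 48 36 [ node 34 15 [ node 18 17 [] ] ] ∷ node 18 17 [ node 34 15 [ node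
    48 36 [] ] ] ∷ []) ∷ []) ∷ node 12 19 (node 27 21 (node 47 37 [] ∷ node 30 20 [ node 49 35 []
    ] ∷ []) ∷ node 27 21 (node 47 37 [] ∷ node 49 35 [ node 30 20 [] ] ∷ []) ∷ []) ∷ node 12 19
    (node 27 21 (node 47 37 [] ∷ node 30 20 [ node 49 35 [] ] ∷ []) ∷ node 27 21 (node 47 37 [] ∷
    node 30 20 [ node 49 35 [] ] ∷ []) ∷ []) ∷ node 30 18 (node 47 37 [] ∷ node 49 35 [ node 31 19
    [ node 12 20 [] ] ] ∷ node 12 20 [ node 31 19 [ node 49 35 [] ] ] ∷ []) ∷ []) ∷ node 12 30
    (node 17 31 (node 47 37 [] ∷ node 49 35 [ node 27 23 [] ] ∷ []) ∷ node 17 31 (node 47 37 [] ∷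
    node 49 35 [ node 27 23 [] ] ∷ []) ∷ []) ∷ node 12 30 (node 17 31 (node 47 37 [] ∷ node 27 23
    [ node 49 35 [] ] ∷ []) ∷ node 27 21 (node 47 37 [] ∷ node 28 22 [ node 49 35 [] ] ∷ []) ∷ [])
    ∷ []) ∷ node 10 19 (node 17 15 (node 33 15 (node 47 37 [] ∷ node 18 17 (node 27 9 (node 34 18
    [] ∷ node 34 16 [ node 49 35 [] ] ∷ []) ∷ node 27 10 (node 30 12 [ node 36 16 [] ] ∷ node 30
    12 [ node 36 16 [] ] ∷ []) ∷ []) ∷ node 27 16 (node 42 34 [] ∷ node 18 17 [ node 34 16 [ node
    49 35 [] ] ] ∷ node 18 16 [ node 30 15 [ node 44 32 [] ] ] ∷ []) ∷ node 27 9 (node 28 10 (node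
    30 12 [ node 37 13 [ node 49 35 [] ] ] ∷ node 30 12 [ node 37 13 [ node 49 35 [] ] ] ∷ []) ∷
    node 18 17 [ node 34 16 [ node 49 35 [] ] ] ∷ node 18 17 [ node 34 16 [ node 49 35 [] ] ] ∷
    []) ∷ []) ∷ node 27 21 (node 47 37 [] ∷ node 49 35 [ node 30 20 [ node 12 19 [] ] ] ∷ node 12
    19 [ node 30 20 [ node 49 35 [] ] ] ∷ []) ∷ node 27 21 (node 47 37 [] ∷ node 12 19 [ node 49
    35 [ node 30 20 [] ] ] ∷ node 12 19 [ node 30 20 [ node 49 35 [] ] ] ∷ []) ∷ node 27 21 (node
    47 37 [] ∷ node 49 35 [ node 12 19 [ node 30 20 [] ] ] ∷ node 12 19 [ node 30 20 [ node 49 35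
    [] ] ] ∷ []) ∷ []) ∷ node 12 30 (node 17 35 [] ∷ node 48 36 [ node 17 30 [ node 27 22 [] ] ] ∷
    []) ∷ node 48 36 [ node 12 30 (node 17 30 [ node 27 22 [] ] ∷ node 17 30 [ node 27 22 [] ] ∷
    []) ] ∷ []) ∷ node 12 40 [ node 10 37 [] ] ∷ []) ∷ []) ∷ []) ∷ []) ∷ []) ∷ []) ∷ []) ]) , _

theorem1p1 : (A : OnlineAlgorithm) → fromℚ (+ 7 / 4) ≤ᵘ strictCompetitiveRatio A
theorem1p1 A q (ρ , competitive , ρ<q) with + 7 / 4 ℚ.<? q
... | yes 7/4<q = fromℚ-mono-< 7/4<q
-- It remains to derive a contradiction, so the doubly negated existence of `m` and `k` may be used.
-- The 4-colouring bounds `k` by 4, and the seven colours of the play bound `m` from below.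
... | no  7/4≮q =
  ⊥-elim (¬¬-onlineChromaticNumber A (presentation realised) λ (m , used≤m , online) →
  ¬¬-least 4 (4-colourable realised) λ (k , colourable , least) →
  7/4≮q (ratio-bound {ρ} {q} {m} {k} ρ<q
    (competitive (graph spans) (isUnitIntervalGraph realised) m k online (colourable , least))
    (ℕ.≤-trans seven (ℕ.≤-trans (length≤coloursUsed realised unique used) used≤m))
    (least 4 (4-colourable realised))))
  where
  open Replies A
  open Game 1048575 reply history-proper
  -- The play starts from the empty position, for which the invariant is trivial.
  open SevenColours (wins⇒seven (proj₁ winning-tree) (classes [] [] []) (proj₂ winning-tree))
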